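{- Let $k\ge 1$, let $X_1,\dots,X_k$ be pairwise disjoint finite nonempty sets with $|X_i|=n_i$, let $G=\prod_{i=1}^k\mathrm{GL}(n_i)$, and for each $i$ let $V_i\cong\mathbb C^{n_i}$ be the fundamental representation of $\mathrm{GL}(n_i)$. Let $P(\mathbf x)=\sum_{f\in\mathrm{EC}}w(f)$ be the generating polynomial of eventually constant $k$-tuples on $X_1,\dots,X_k$. Then $P(\mathbf x)$ can be written as the virtual character $$P(\mathbf x)=\chi\!\left(\bigotimes_{i=1}^k V_i^{\otimes n_{i-1}}-2^k\bigotimes_{i=1}^k\left(V_i^{\otimes(n_{i-1}-2)}\otimes\Lambda^2V_i\right)\right),$$ with indices understood modulo $k$.
   Context: Indices are modulo $k$, so $X_{k+1}=X_1$ and $n_0=n_k$. A $k$-tuple $f=(f_1,\dots,f_k)$ with $f_i:X_i\to X_{i+1}$ is eventually constant if $(f_k\cdots f_1)^m:X_1\to X_1$ is constant for some $m\ge1$; $\mathrm{EC}$ is the set of these. There is one commuting variable $x_v$ for each $v\in\bigsqcup_iX_i$, and $w(f)=\prod_{i=1}^k\prod_{v\in X_i}x_{f_i(v)}$. Each $V_i$ is regarded as a representation of $G$ through the projection $G\to\mathrm{GL}(n_i)$. For a representation $W$ of $G$, $\chi(W)$ is its character as a function of $\mathbf x=(x_v)$: the trace on $W$ of the element $(\mathrm{diag}(x_v)_{v\in X_1},\dots,\mathrm{diag}(x_v)_{v\in X_k})$; $\chi$ is extended additively to formal integer combinations (virtual representations). If some $n_j=1$, then $\Lambda^2V_j=0$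 and the second tensor product is read as $0$. -}

module Defs where

open import Algebra.Bundles
  using (Monoid; Group; CommutativeRing)
open import Algebra.Morphism.Structures using (module MonoidMorphisms)
import Algebra.Properties.CommutativeMonoid.Sum
import Algebra.Properties.Monoid.Mult
import Algebra.Properties.Ring
import Algebra.Properties.Semiring.Sum
open import Data.Bool.Base using (if_then_else_)
open import Data.Fin.Base
  using (Fin; zero; suc; toℕ; splitAt; remQuot; combine; _↑ˡ_; _↑ʳ_; funToFin; finToFun)
import Data.Fin.Properties as Fin
open import Data.Integer.Base using (ℤ; +_; -[1+_])
import Data.Integer.Base as ℤ
open import Data.List.Base
  using (List; []; _∷_; _++_; map; foldr; filter; tabulate; cartesianProductWith)
open import Data.Nat.Base
  using (ℕ; zero; suc; pred; z≤n; s≤s; NonZero; _≤_; _<_)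
import Data.Nat.Base as ℕ
open import Data.Nat.DivMod using (_%_; _mod_; %-distribˡ-+; [m+n]%n≡m%n; m<n⇒m%n≡m; m%n%n≡m%n)
import Data.Nat.Properties as ℕ
open import Data.Product.Base
  using (∃-syntax; _×_; _,_; proj₁; proj₂; uncurry)
import Data.Product.Base as Product
open import Data.Sum.Base using (inj₁; inj₂; [_,_]′)
import Data.Vec.Functional as Vector
open import Function.Base using (_∘_; const)
open import Function.Bundles using (_↔_; Inverse)
import Function.Endo.Propositional as Endo
open import Level using (Level; _⊔_)
open import Relation.Binary.PropositionalEquality
  using (_≡_; _≢_; _≗_; refl; sym; trans; cong; cong₂; subst; module ≡-Reasoning)
import Relation.Binary.Reasoning.Setoid
open import Relation.Nullary using (Dec; yes; no; does; contradiction)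
open import Relation.Nullary.Decidable using (map′)

module _ {c ℓ : Level} where

  module _ (M : Monoid c ℓ) where
    open Monoid M renaming (refl to ≈-refl; sym to ≈-sym; trans to ≈-trans)

    record Unit : Set (c ⊔ ℓ) where
      field
        value    : Carrier
        inverse  : Carrier
        inverseˡ : inverse ∙ value ≈ ε
        inverseʳ : value ∙ inverse ≈ ε

    open Unit

    private
      cancel : ∀ {a b c d} → b ∙ c ≈ ε → a ∙ d ≈ ε → (a ∙ b) ∙ (c ∙ d) ≈ ε
      cancel {a} {b} {c} {d} bc ad = begin
        (a ∙ b) ∙ (c ∙ d)  ≈⟨ assoc a b (c ∙ d) ⟩
        a ∙ (b ∙ (c ∙ d))  ≈⟨ ∙-congˡ (assoc b c d) ⟨
        a ∙ ((b ∙ c) ∙ d)  ≈⟨ ∙-congˡ (∙-congʳ bc) ⟩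
        a ∙ (ε ∙ d)        ≈⟨ ∙-congˡ (identityˡ d) ⟩
        a ∙ d              ≈⟨ ad ⟩
        ε                  ∎
        where open Relation.Binary.Reasoning.Setoid setoid

      inverse-unique : ∀ (g h : Unit) → value g ≈ value h → inverse g ≈ inverse h
      inverse-unique g h g≈h = begin
        inverse g                            ≈⟨ identityʳ _ ⟨
        inverse g ∙ ε                        ≈⟨ ∙-congˡ (inverseʳ h) ⟨
        inverse g ∙ (value h ∙ inverse h)    ≈⟨ assoc _ _ _ ⟨
        (inverse g ∙ value h) ∙ inverse h    ≈⟨ ∙-congʳ (∙-congˡ g≈h) ⟨
        (inverse g ∙ value g) ∙ inverse h    ≈⟨ ∙-congʳ (inverseˡ g) ⟩
        ε ∙ inverse h                        ≈⟨ identityˡ _ ⟩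
        inverse h                            ∎
        where open Relation.Binary.Reasoning.Setoid setoid

    unitGroup : Group (c ⊔ ℓ) ℓ
    unitGroup = record
      { Carrier = Unit
      ; _≈_     = λ g h → value g ≈ value h
      ; _∙_     = λ g h → record
          { value    = value g ∙ value h
          ; inverse  = inverse h ∙ inverse g
          ; inverseˡ = cancel (inverseˡ g) (inverseˡ h)
          ; inverseʳ = cancel (inverseʳ h) (inverseʳ g)
          }
      ; ε       = record
          { value = ε ; inverse = ε ; inverseˡ = identityˡ ε ; inverseʳ = identityʳ ε }
      ; _⁻¹     = λ g → record
          { value    = inverse g
          ; inverse  = value g
          ; inverseˡ = inverseʳ g
          ; inverseʳ = inverseˡ g
          }
      ; isGroup = record
          { isMonoid = record
              { isSemigroup = record
                  { isMagma = record
                      { isEquivalence = record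
                          { refl = ≈-refl ; sym = ≈-sym ; trans = ≈-trans }
                      ; ∙-cong = ∙-cong
                      }
                  ; assoc = λ g h k → assoc (value g) (value h) (value k)
                  }
              ; identity = (λ g → identityˡ (value g)) , (λ g → identityʳ (value g))
              }
          ; inverse = inverseˡ , inverseʳ
          ; ⁻¹-cong = λ {g} {h} → inverse-unique g h
          }
      }

  ∏-group : ∀ {k} → (Fin k → Group c ℓ) → Group c ℓ
  ∏-group G = record
    { Carrier = ∀ i → Group.Carrier (G i)
    ; _≈_     = λ g h → ∀ i → Group._≈_ (G i) (g i) (h i)
    ; _∙_     = λ g h i → Group._∙_ (G i) (g i) (h i)
    ; ε       = λ i → Group.ε (G i)
    ; _⁻¹     = λ g i → Group._⁻¹ (G i) (g i)
    ; isGroup = record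
        { isMonoid = record
            { isSemigroup = record
                { isMagma = record
                    { isEquivalence = record
                        { refl  = λ i → Group.refl (G i)
                        ; sym   = λ p i → Group.sym (G i) (p i)
                        ; trans = λ p q i → Group.trans (G i) (p i) (q i)
                        }
                    ; ∙-cong = λ p q i → Group.∙-cong (G i) (p i) (q i)
                    }
                ; assoc = λ g h l i → Group.assoc (G i) (g i) (h i) (l i)
                }
            ; identity = (λ g i → Group.identityˡ (G i) (g i))
                       , (λ g i → Group.identityʳ (G i) (g i))
            }
        ; inverse = (λ g i → Group.inverseˡ (G i) (g i))
                  , (λ g i → Group.inverseʳ (G i) (g i))
        ; ⁻¹-cong = λ p i → Group.⁻¹-cong (G i) (p i)
        }
    }

-- The ground ring is an arbitrary commutative ring R, the library having no complex
-- numbers.  The diagonal elements of GL d have units of R on the diagonal, so an identity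
-- of characters holding for all R, in particular for Laurent polynomials over ℤ or ℂ, is
-- an identity of polynomials in commuting variables.
module Representations {r ℓ : Level} (R : CommutativeRing r ℓ) where
  open CommutativeRing R
    renaming (refl to ≈-refl; sym to ≈-sym; trans to ≈-trans; Carrier to A)
    hiding (zero)
  open Algebra.Properties.Semiring.Sum semiring
  open Algebra.Properties.Monoid.Mult +-monoid using () renaming (_×_ to _ℕ·_)
  open Algebra.Properties.Ring ring using (-‿distribʳ-*; -‿+-comm; -0#≈0#)
  open Relation.Binary.Reasoning.Setoid setoid

  Matrix : ℕ → Set r
  Matrix d = Fin d → Fin d → A

  infix 4 _≈ᴹ_
  _≈ᴹ_ : ∀ {d} → Matrix d → Matrix d → Set ℓ
  M ≈ᴹ N = ∀ i j → M i j ≈ N i j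

  infixl 7 _*ᴹ_
  _*ᴹ_ : ∀ {d} → Matrix d → Matrix d → Matrix d
  _*ᴹ_ {d} M N i j = ∑[ k < d ] (M i k * N k j)

  diagonal : ∀ {d} → (Fin d → A) → Matrix d
  diagonal t i j = if does (i Fin.≟ j) then t i else 0#

  1ᴹ : ∀ {d} → Matrix d
  1ᴹ = diagonal (const 1#)

  trace : ∀ {d} → Matrix d → A
  trace {d} M = ∑[ i < d ] M i i

  diagonal-same : ∀ {d} (t : Fin d → A) i → diagonal t i i ≡ t i
  diagonal-same t i with i Fin.≟ i
  ... | yes _  = refl
  ... | no i≢i = contradiction refl i≢i

  diagonal-diff : ∀ {d} (t : Fin d → A) {i j} → i ≢ j → diagonal t i j ≡ 0#
  diagonal-diff t {i} {j} i≢j with i Fin.≟ j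
  ... | yes i≡j = contradiction i≡j i≢j
  ... | no _    = refl

  sum-zero : ∀ {d} {f : Fin d → A} → (∀ i → f i ≈ 0#) → sum f ≈ 0#
  sum-zero {d} f≈0 = ≈-trans (sum-cong-≋ f≈0) (sum-replicate-zero d)

  diagonal-*ˡ : ∀ {d} (t : Fin d → A) (v : Fin d → A) i →
                ∑[ k < d ] (diagonal t i k * v k) ≈ t i * v i
  diagonal-*ˡ {suc d} t v zero =
    ≈-trans (+-congˡ (sum-zero (λ k → zeroˡ (v (suc k))))) (+-identityʳ _)
  diagonal-*ˡ {suc d} t v (suc i) =
    ≈-trans (+-cong (zeroˡ _) (diagonal-*ˡ (t ∘ suc) (v ∘ suc) i)) (+-identityˡ _)

  diagonal-*ʳ : ∀ {d} (t : Fin d → A) (v : Fin d → A) j →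
                ∑[ k < d ] (v k * diagonal t k j) ≈ v j * t j
  diagonal-*ʳ {suc d} t v zero =
    ≈-trans (+-congˡ (sum-zero (λ k → zeroʳ (v (suc k))))) (+-identityʳ _)
  diagonal-*ʳ {suc d} t v (suc j) =
    ≈-trans (+-cong (zeroʳ _) (diagonal-*ʳ (t ∘ suc) (v ∘ suc) j)) (+-identityˡ _)

  diagonal-cong : ∀ {d} {s t : Fin d → A} → (∀ i → s i ≈ t i) → diagonal s ≈ᴹ diagonal t
  diagonal-cong s≈t i j with i Fin.≟ j
  ... | yes _ = s≈t i
  ... | no _  = ≈-refl

  diagonal-* : ∀ {d} (s t : Fin d → A) →
               diagonal s *ᴹ diagonal t ≈ᴹ diagonal (λ i → s i * t i)
  diagonal-* s t i j = ≈-trans (diagonal-*ˡ s (λ k → diagonal t k j) i) (case i j)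
    where
    case : ∀ i j → s i * diagonal t i j ≈ diagonal (λ i → s i * t i) i j
    case i j with i Fin.≟ j
    ... | yes _ = ≈-refl
    ... | no _  = zeroʳ (s i)

  *ᴹ-assoc : ∀ {d} (L M N : Matrix d) → (L *ᴹ M) *ᴹ N ≈ᴹ L *ᴹ (M *ᴹ N)
  *ᴹ-assoc {d} L M N i j = begin
    ∑[ l < d ] ((∑[ k < d ] (L i k * M k l)) * N l j)
      ≈⟨ sum-cong-≋ (λ l → *-distribʳ-sum (N l j) (λ k → L i k * M k l)) ⟩
    ∑[ l < d ] ∑[ k < d ] (L i k * M k l * N l j)
      ≈⟨ ∑-comm (λ l k → L i k * M k l * N l j) ⟩
    ∑[ k < d ] ∑[ l < d ] (L i k * M k l * N l j)
      ≈⟨ sum-cong-≋ (λ k → sum-cong-≋ (λ l → *-assoc (L i k) (M k l) (N l j))) ⟩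
    ∑[ k < d ] ∑[ l < d ] (L i k * (M k l * N l j))
      ≈⟨ sum-cong-≋ (λ k → *-distribˡ-sum (L i k) (λ l → M k l * N l j)) ⟨
    ∑[ k < d ] (L i k * (∑[ l < d ] (M k l * N l j))) ∎

  matrixMonoid : ℕ → Monoid r ℓ
  matrixMonoid d = record
    { Carrier  = Matrix d
    ; _≈_      = _≈ᴹ_
    ; _∙_      = _*ᴹ_
    ; ε        = 1ᴹ
    ; isMonoid = record
        { isSemigroup = record
            { isMagma = record
                { isEquivalence = record
                    { refl  = λ i j → ≈-refl
                    ; sym   = λ p i j → ≈-sym (p i j)
                    ; trans = λ p q i j → ≈-trans (p i j) (q i j)
                    }
                ; ∙-cong = λ p q i j → sum-cong-≋ (λ k → *-cong (p i k) (q k j))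
                }
            ; assoc = *ᴹ-assoc
            }
        ; identity =
              (λ M i j → ≈-trans (diagonal-*ˡ _ (λ k → M k j) i) (*-identityˡ _))
            , (λ M i j → ≈-trans (diagonal-*ʳ _ (M i) j) (*-identityʳ _))
        }
    }

  GL : ℕ → Group (r ⊔ ℓ) ℓ
  GL d = unitGroup (matrixMonoid d)

  diag : ∀ {d} → (Fin d → Unit *-monoid) → Group.Carrier (GL d)
  diag t = record
    { value    = diagonal (value ∘ t)
    ; inverse  = diagonal (inverse ∘ t)
    ; inverseˡ = λ i j → ≈-trans (diagonal-* (inverse ∘ t) (value ∘ t) i j)
                                 (diagonal-cong (λ l → inverseˡ (t l)) i j)
    ; inverseʳ = λ i j → ≈-trans (diagonal-* (value ∘ t) (inverse ∘ t) i j)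
                                 (diagonal-cong (λ l → inverseʳ (t l)) i j)
    }
    where open Unit

  -- Representations on free modules of finite rank with a chosen basis.  A monoid
  -- homomorphism from a group to matrices automatically lands in GL dim.
  record Representation {g ℓg} (G : Group g ℓg) : Set (r ⊔ ℓ ⊔ g ⊔ ℓg) where
    field
      dim   : ℕ
      ρ     : Group.Carrier G → Matrix dim
      isHom : MonoidMorphisms.IsMonoidHomomorphism
                (Group.rawMonoid G) (Monoid.rawMonoid (matrixMonoid dim)) ρ

    open MonoidMorphisms.IsMonoidHomomorphism isHom public

  sum-++ : ∀ m {n} (f : Fin (m ℕ.+ n) → A) →
           sum f ≈ ∑[ i < m ] f (i ↑ˡ n) + ∑[ j < n ] f (m ↑ʳ j)
  sum-++ zero    f = ≈-sym (+-identityˡ _)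
  sum-++ (suc m) f = ≈-trans (+-congˡ (sum-++ m (f ∘ suc))) (≈-sym (+-assoc _ _ _))

  sum-combine : ∀ m {n} (f : Fin (m ℕ.* n) → A) →
                sum f ≈ ∑[ i < m ] ∑[ j < n ] f (combine i j)
  sum-combine zero        f = ≈-refl
  sum-combine (suc m) {n} f =
    ≈-trans (sum-++ n f) (+-congˡ (sum-combine m (λ l → f (n ↑ʳ l))))

  sum-remQuot : ∀ m n (f : Fin m × Fin n → A) →
                ∑[ l < m ℕ.* n ] f (remQuot n l) ≈ ∑[ i < m ] ∑[ j < n ] f (i , j)
  sum-remQuot m n f = ≈-trans (sum-combine m (f ∘ remQuot n))
    (sum-cong-≋ (λ i → sum-cong-≋ (λ j → reflexive (cong f (Fin.remQuot-combine i j)))))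

  *-interchange : ∀ a b c d → (a * b) * (c * d) ≈ (a * c) * (b * d)
  *-interchange a b c d = begin
    (a * b) * (c * d)  ≈⟨ *-assoc a b (c * d) ⟩
    a * (b * (c * d))  ≈⟨ *-congˡ (*-assoc b c d) ⟨
    a * ((b * c) * d)  ≈⟨ *-congˡ (*-congʳ (*-comm b c)) ⟩
    a * ((c * b) * d)  ≈⟨ *-congˡ (*-assoc c b d) ⟩
    a * (c * (b * d))  ≈⟨ *-assoc a c (b * d) ⟨
    (a * c) * (b * d)  ∎

  sum-* : ∀ {m n} (f : Fin m → A) (g : Fin n → A) →
          sum f * sum g ≈ ∑[ i < m ] ∑[ j < n ] (f i * g j)
  sum-* f g = ≈-trans (*-distribʳ-sum (sum g) f)
    (sum-cong-≋ (λ i → *-distribˡ-sum (f i) g))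

  kronecker : ∀ {d e} → Matrix d → Matrix e → Matrix (d ℕ.* e)
  kronecker {d} {e} M N p q =
    M (proj₁ (remQuot {d} e p)) (proj₁ (remQuot {d} e q)) *
    N (proj₂ (remQuot {d} e p)) (proj₂ (remQuot {d} e q))

  kronecker-* : ∀ {d e} (M M′ : Matrix d) (N N′ : Matrix e) →
                kronecker (M *ᴹ M′) (N *ᴹ N′) ≈ᴹ kronecker M N *ᴹ kronecker M′ N′
  kronecker-* {d} {e} M M′ N N′ p q = begin
    (∑[ k < d ] (M i k * M′ k j)) * (∑[ l < e ] (N i′ l * N′ l j′))
      ≈⟨ sum-* (λ k → M i k * M′ k j) (λ l → N i′ l * N′ l j′) ⟩
    ∑[ k < d ] ∑[ l < e ] ((M i k * M′ k j) * (N i′ l * N′ l j′))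
      ≈⟨ sum-cong-≋ (λ k → sum-cong-≋ (λ l → *-interchange (M i k) (M′ k j) (N i′ l) (N′ l j′))) ⟩
    ∑[ k < d ] ∑[ l < e ] ((M i k * N i′ l) * (M′ k j * N′ l j′))
      ≈⟨ sum-remQuot d e (λ (k , l) → (M i k * N i′ l) * (M′ k j * N′ l j′)) ⟨
    (kronecker M N *ᴹ kronecker M′ N′) p q ∎
    where
    i  = proj₁ (remQuot {d} e p)
    i′ = proj₂ (remQuot {d} e p)
    j  = proj₁ (remQuot {d} e q)
    j′ = proj₂ (remQuot {d} e q)

  kronecker-1 : ∀ {d e} → kronecker (1ᴹ {d}) (1ᴹ {e}) ≈ᴹ 1ᴹ
  kronecker-1 {d} {e} p q with p Fin.≟ q
  ... | yes refl = begin
    1ᴹ (proj₁ (remQuot {d} e p)) (proj₁ (remQuot {d} e p)) *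
    1ᴹ (proj₂ (remQuot {d} e p)) (proj₂ (remQuot {d} e p))
      ≡⟨ cong₂ _*_ (diagonal-same {d} (const 1#) (proj₁ (remQuot {d} e p)))
                   (diagonal-same {e} (const 1#) (proj₂ (remQuot {d} e p))) ⟩
    1# * 1#  ≈⟨ *-identityˡ 1# ⟩
    1#       ∎
  ... | no p≢q
    with proj₁ (remQuot {d} e p) Fin.≟ proj₁ (remQuot {d} e q)
       | proj₂ (remQuot {d} e p) Fin.≟ proj₂ (remQuot {d} e q)
  ... | no _  | _     = zeroˡ _
  ... | yes _ | no _  = zeroʳ _
  ... | yes a | yes b = contradiction
    (trans (sym (Fin.combine-remQuot {d} e p))
      (trans (cong₂ combine a b) (Fin.combine-remQuot {d} e q))) p≢q

  pairCount : ℕ → ℕ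
  pairCount zero    = 0
  pairCount (suc d) = d ℕ.+ pairCount d

  -- Enumerates, without repetition, the pairs (a , b) with a < b.
  pair : ∀ d → Fin (pairCount d) → Fin d × Fin d
  pair (suc d) p =
    [ (λ b → zero , suc b) , (λ q → Product.map suc suc (pair d q)) ]′ (splitAt d p)

  -- The matrix of Λ²M in the basis (e_a ∧ e_b), a < b: the coefficient of e_a ∧ e_b
  -- in M e_c ∧ M e_d is the 2 × 2 minor of M with rows a, b and columns c, d.
  exteriorSquare : ∀ {n} → Matrix n → Matrix (pairCount n)
  exteriorSquare {n} M p q =
    let (a , b) = pair n p
        (c , d) = pair n q
    in M a c * M b d - M a d * M b c

  sum-pairs : ∀ {d} (h : Fin d → Fin d → A) →
    ∑[ a < d ] ∑[ b < d ] h a b ≈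
    ∑[ a < d ] h a a +
    ∑[ p < pairCount d ] uncurry (λ a b → h a b + h b a) (pair d p)
  sum-pairs {zero}  h = ≈-sym (+-identityˡ 0#)
  sum-pairs {suc d} h = begin
    (h zero zero + ∑[ b < d ] h zero (suc b)) +
      ∑[ a < d ] (h (suc a) zero + ∑[ b < d ] h (suc a) (suc b))
      ≈⟨ +-congˡ (∑-distrib-+ (λ a → h (suc a) zero) (λ a → ∑[ b < d ] h (suc a) (suc b))) ⟩
    (h zero zero + S₁) + (S₂ + ∑[ a < d ] ∑[ b < d ] h (suc a) (suc b))
      ≈⟨ +-congˡ (+-congˡ (sum-pairs (λ a b → h (suc a) (suc b)))) ⟩
    (h zero zero + S₁) + (S₂ + (D + Q))
      ≈⟨ rearrange (h zero zero) S₁ S₂ D Q ⟩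
    (h zero zero + D) + ((S₁ + S₂) + Q)
      ≈⟨ +-congˡ (+-congʳ (∑-distrib-+ (λ b → h zero (suc b)) (λ b → h (suc b) zero))) ⟨
    (h zero zero + D) + (∑[ b < d ] (h zero (suc b) + h (suc b) zero) + Q)
      ≈⟨ +-congˡ (+-cong
           (sum-cong-≋ (λ b → reflexive (cong F (pair-left b))))
           (sum-cong-≋ (λ q → reflexive (cong F (pair-right q))))) ⟨
    (h zero zero + D) + (∑[ b < d ] F (pair (suc d) (b ↑ˡ pairCount d)) +
                         ∑[ q < pairCount d ] F (pair (suc d) (d ↑ʳ q)))
      ≈⟨ +-congˡ (sum-++ d (λ p → F (pair (suc d) p))) ⟨
    (h zero zero + D) + ∑[ p < pairCount (suc d) ] F (pair (suc d) p) ∎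
    where
    F : Fin (suc d) × Fin (suc d) → A
    F (a , b) = h a b + h b a
    S₁ = ∑[ b < d ] h zero (suc b)
    S₂ = ∑[ a < d ] h (suc a) zero
    D  = ∑[ a < d ] h (suc a) (suc a)
    Q  = ∑[ p < pairCount d ] F (Product.map suc suc (pair d p))
    pair-left : ∀ b → pair (suc d) (b ↑ˡ pairCount d) ≡ (zero , suc b)
    pair-left b rewrite Fin.splitAt-↑ˡ d b (pairCount d) = refl
    pair-right : ∀ q → pair (suc d) (d ↑ʳ q) ≡ Product.map suc suc (pair d q)
    pair-right q rewrite Fin.splitAt-↑ʳ d (pairCount d) q = refl
    rearrange : ∀ a b c d e → (a + b) + (c + (d + e)) ≈ (a + d) + ((b + c) + e)
    rearrange a b c d e = begin
      (a + b) + (c + (d + e))  ≈⟨ +-assoc a b _ ⟩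
      a + (b + (c + (d + e)))  ≈⟨ +-congˡ (+-assoc b c _) ⟨
      a + ((b + c) + (d + e))  ≈⟨ +-congˡ (+-assoc (b + c) d e) ⟨
      a + (((b + c) + d) + e)  ≈⟨ +-congˡ (+-congʳ (+-comm (b + c) d)) ⟩
      a + ((d + (b + c)) + e)  ≈⟨ +-congˡ (+-assoc d (b + c) e) ⟩
      a + (d + ((b + c) + e))  ≈⟨ +-assoc a d _ ⟨
      (a + d) + ((b + c) + e)  ∎

  *-distribˡ-- : ∀ x y z → x * (y - z) ≈ x * y - x * z
  *-distribˡ-- x y z = ≈-trans (distribˡ x y (- z)) (+-congˡ (≈-sym (-‿distribʳ-* x z)))

  sum-neg : ∀ {d} (f : Fin d → A) → ∑[ i < d ] (- f i) ≈ - sum f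
  sum-neg {zero}  f = ≈-sym -0#≈0#
  sum-neg {suc d} f = ≈-trans (+-congˡ (sum-neg (f ∘ suc))) (-‿+-comm _ _)

  *-distribʳ-- : ∀ x y z → (y - z) * x ≈ y * x - z * x
  *-distribʳ-- x y z = begin
    (y - z) * x    ≈⟨ *-comm _ x ⟩
    x * (y - z)    ≈⟨ *-distribˡ-- x y z ⟩
    x * y - x * z  ≈⟨ +-cong (*-comm x y) (-‿cong (*-comm x z)) ⟩
    y * x - z * x  ∎

  -‿flip : ∀ y z → z - y ≈ - (y - z)
  -‿flip y z = ≈-sym (begin
    - (y - z)      ≈⟨ -‿+-comm y (- z) ⟨
    - y + - (- z)  ≈⟨ +-congˡ (Algebra.Properties.Ring.-‿involutive ring z) ⟩
    - y + z        ≈⟨ +-comm (- y) z ⟩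
    z - y          ∎)

  exteriorSquare-* : ∀ {d} (M N : Matrix d) →
    exteriorSquare (M *ᴹ N) ≈ᴹ exteriorSquare M *ᴹ exteriorSquare N
  exteriorSquare-* {n} M N p q = begin
    sum (λ e → M a e * N e c) * sum (λ f → M b f * N f d) -
    sum (λ e → M a e * N e d) * sum (λ f → M b f * N f c)
      ≈⟨ +-cong (sum-* (λ e → M a e * N e c) (λ f → M b f * N f d))
                (-‿cong (sum-* (λ e → M a e * N e d) (λ f → M b f * N f c))) ⟩
    ∑[ e < n ] ∑[ f < n ] U e f - ∑[ e < n ] ∑[ f < n ] W e f
      ≈⟨ +-congˡ (≈-trans (sum-cong-≋ (λ e → sum-neg (W e))) (sum-neg (λ e → sum (W e)))) ⟨
    ∑[ e < n ] ∑[ f < n ] U e f + ∑[ e < n ] ∑[ f < n ] (- W e f)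
      ≈⟨ ∑-distrib-+ (λ e → sum (U e)) (λ e → ∑[ f < n ] (- W e f)) ⟨
    ∑[ e < n ] (∑[ f < n ] U e f + ∑[ f < n ] (- W e f))
      ≈⟨ sum-cong-≋ (λ e → ∑-distrib-+ (U e) (λ f → - W e f)) ⟨
    ∑[ e < n ] ∑[ f < n ] (U e f - W e f)
      ≈⟨ sum-cong-≋ (λ e → sum-cong-≋ (λ f → factor e f)) ⟩
    ∑[ e < n ] ∑[ f < n ] H e f
      ≈⟨ sum-pairs H ⟩
    ∑[ e < n ] H e e + ∑[ r < pairCount n ] uncurry (λ e f → H e f + H f e) (pair n r)
      ≈⟨ +-cong (sum-zero H-diag) (sum-cong-≋ (λ r → H-swap (proj₁ (pair n r)) (proj₂ (pair n r)))) ⟩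
    0# + (exteriorSquare M *ᴹ exteriorSquare N) p q
      ≈⟨ +-identityˡ _ ⟩
    (exteriorSquare M *ᴹ exteriorSquare N) p q ∎
    where
    a = proj₁ (pair n p)
    b = proj₂ (pair n p)
    c = proj₁ (pair n q)
    d = proj₂ (pair n q)
    U W H : Fin n → Fin n → A
    U e f = (M a e * N e c) * (M b f * N f d)
    W e f = (M a e * N e d) * (M b f * N f c)
    H e f = (M a e * M b f) * (N e c * N f d - N e d * N f c)
    factor : ∀ e f → U e f - W e f ≈ H e f
    factor e f = ≈-trans
      (+-cong (*-interchange (M a e) (N e c) (M b f) (N f d))
              (-‿cong (*-interchange (M a e) (N e d) (M b f) (N f c))))
      (≈-sym (*-distribˡ-- (M a e * M b f) (N e c * N f d) (N e d * N f c)))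
    H-diag : ∀ e → H e e ≈ 0#
    H-diag e = begin
      (M a e * M b e) * (N e c * N e d - N e d * N e c)
        ≈⟨ *-congˡ (+-congˡ (-‿cong (*-comm (N e d) (N e c)))) ⟩
      (M a e * M b e) * (N e c * N e d - N e c * N e d)
        ≈⟨ *-congˡ (-‿inverseʳ _) ⟩
      (M a e * M b e) * 0#  ≈⟨ zeroʳ _ ⟩
      0#                    ∎
    H-swap : ∀ e f → H e f + H f e ≈
      (M a e * M b f - M a f * M b e) * (N e c * N f d - N e d * N f c)
    H-swap e f = begin
      x * w + (M a f * M b e) * (N f c * N e d - N f d * N e c)
        ≈⟨ +-congˡ (*-congˡ (+-cong (*-comm (N f c) (N e d)) (-‿cong (*-comm (N f d) (N e c))))) ⟩
      x * w + y * (N e d * N f c - N e c * N f d)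
        ≈⟨ +-congˡ (*-congˡ (-‿flip (N e c * N f d) (N e d * N f c))) ⟩
      x * w + y * - w  ≈⟨ +-congˡ (-‿distribʳ-* y w) ⟨
      x * w - y * w    ≈⟨ *-distribʳ-- w x y ⟨
      (x - y) * w      ∎
      where
      x = M a e * M b f
      y = M a f * M b e
      w = N e c * N f d - N e d * N f c

  pair-< : ∀ d (p : Fin (pairCount d)) →
           toℕ (proj₁ (pair d p)) < toℕ (proj₂ (pair d p))
  pair-< (suc d) p with splitAt d p
  ... | inj₁ b = ℕ.z<s
  ... | inj₂ q = ℕ.s<s (pair-< d q)

  pair-injective : ∀ d (p q : Fin (pairCount d)) →
    proj₁ (pair d p) ≡ proj₁ (pair d q) → proj₂ (pair d p) ≡ proj₂ (pair d q) → p ≡ q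
  pair-injective (suc d) p q with splitAt d p in eqp | splitAt d q in eqq
  ... | inj₁ b | inj₁ b′ = λ _ e → trans (sym (Fin.splitAt⁻¹-↑ˡ eqp))
        (trans (cong (_↑ˡ pairCount d) (Fin.suc-injective e)) (Fin.splitAt⁻¹-↑ˡ eqq))
  ... | inj₁ b | inj₂ q′ = λ ()
  ... | inj₂ p′ | inj₁ b = λ ()
  ... | inj₂ p′ | inj₂ q′ = λ e e′ → trans (sym (Fin.splitAt⁻¹-↑ʳ eqp))
        (trans (cong (d ↑ʳ_) (pair-injective d p′ q′ (Fin.suc-injective e) (Fin.suc-injective e′)))
               (Fin.splitAt⁻¹-↑ʳ eqq))

  exteriorSquare-1 : ∀ {d} → exteriorSquare (1ᴹ {d}) ≈ᴹ 1ᴹ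
  exteriorSquare-1 {n} p q = ≈-trans (+-congˡ (≈-trans (-‿cong cross) -0#≈0#))
                                 (≈-trans (+-identityʳ _) straight)
    where
    a = proj₁ (pair n p)
    b = proj₂ (pair n p)
    c = proj₁ (pair n q)
    d = proj₂ (pair n q)
    cross : 1ᴹ a d * 1ᴹ b c ≈ 0#
    cross with a Fin.≟ d | b Fin.≟ c
    ... | no _    | _       = zeroˡ _
    ... | yes _   | no _    = zeroʳ _
    ... | yes a≡d | yes b≡c = contradiction
      (ℕ.<-trans (pair-< n p) (subst (λ z → toℕ z < toℕ a) (sym b≡c)
        (subst (λ z → toℕ c < toℕ z) (sym a≡d) (pair-< n q)))) (ℕ.<-irrefl refl)
    straight : 1ᴹ a c * 1ᴹ b d ≈ 1ᴹ p q
    straight with p Fin.≟ q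
    ... | yes refl = ≈-trans (reflexive (cong₂ _*_ (diagonal-same {n} (const 1#) a)
                                                    (diagonal-same {n} (const 1#) b)))
                             (*-identityˡ 1#)
    ... | no p≢q with a Fin.≟ c | b Fin.≟ d
    ...   | no _    | _       = zeroˡ _
    ...   | yes _   | no _    = zeroʳ _
    ...   | yes a≡c | yes b≡d = contradiction (pair-injective n p q a≡c b≡d) p≢q

  module _ {g ℓg : Level} {G : Group g ℓg} where
    open Representation

    trivial : Representation G
    trivial = record
      { dim   = 1
      ; ρ     = λ _ → 1ᴹ
      ; isHom = record
          { isMagmaHomomorphism = record
              { isRelHomomorphism = record { cong = λ _ _ _ → ≈-refl }
              ; homo = λ _ _ i j → ≈-sym (Monoid.identityˡ (matrixMonoid 1) (1ᴹ {1}) i j)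
              }
          ; ε-homo = λ _ _ → ≈-refl
          }
      }

    infixl 7 _⊗_
    _⊗_ : Representation G → Representation G → Representation G
    W ⊗ Z = record
      { dim   = dim W ℕ.* dim Z
      ; ρ     = λ x → kronecker (ρ W x) (ρ Z x)
      ; isHom = record
          { isMagmaHomomorphism = record
              { isRelHomomorphism = record
                  { cong = λ x≈y _ _ → *-cong (⟦⟧-cong W x≈y _ _) (⟦⟧-cong Z x≈y _ _) }
              ; homo = λ x y p q → ≈-trans
                  (*-cong (homo W x y _ _) (homo Z x y _ _))
                  (kronecker-* (ρ W x) (ρ W y) (ρ Z x) (ρ Z y) p q)
              }
          ; ε-homo = λ p q → ≈-trans
              (*-cong (ε-homo W _ _) (ε-homo Z _ _)) (kronecker-1 {dim W} {dim Z} p q)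
          }
      }

    Λ² : Representation G → Representation G
    Λ² W = record
      { dim   = pairCount (dim W)
      ; ρ     = λ x → exteriorSquare (ρ W x)
      ; isHom = record
          { isMagmaHomomorphism = record
              { isRelHomomorphism = record
                  { cong = λ x≈y → exteriorSquare-cong (⟦⟧-cong W x≈y) }
              ; homo = λ x y p q → ≈-trans
                  (exteriorSquare-cong (homo W x y) p q)
                  (exteriorSquare-* (ρ W x) (ρ W y) p q)
              }
          ; ε-homo = λ p q → ≈-trans
              (exteriorSquare-cong (ε-homo W) p q) (exteriorSquare-1 {dim W} p q)
          }
      }
      where
      exteriorSquare-cong : ∀ {d} {M N : Matrix d} → M ≈ᴹ N →
                            exteriorSquare M ≈ᴹ exteriorSquare N
      exteriorSquare-cong M≈N p q =
        +-cong (*-cong (M≈N _ _) (M≈N _ _)) (-‿cong (*-cong (M≈N _ _) (M≈N _ _)))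

    ⨂ : ∀ {m} → (Fin m → Representation G) → Representation G
    ⨂ = Vector.foldr _⊗_ trivial

    infixl 8 _^⊗_
    _^⊗_ : Representation G → ℕ → Representation G
    W ^⊗ m = ⨂ {m} (λ _ → W)

  module _ {g ℓg : Level} (G : Group g ℓg) where

    -- Formal integer combinations.
    VirtualRepresentation : Set (r ⊔ ℓ ⊔ g ⊔ ℓg)
    VirtualRepresentation = List (ℤ × Representation G)

  module _ {g ℓg : Level} {G : Group g ℓg} where

    ⟦_⟧ : Representation G → VirtualRepresentation G
    ⟦ W ⟧ = (+ 1 , W) ∷ []

    infixr 7 _·_
    _·_ : ℤ → VirtualRepresentation G → VirtualRepresentation G
    a · U = map (Product.map₁ (a ℤ.*_)) U

    infixl 6 _⊕_ _⊖_
    _⊕_ : VirtualRepresentation G → VirtualRepresentation G → VirtualRepresentation G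
    _⊕_ = _++_

    _⊖_ : VirtualRepresentation G → VirtualRepresentation G → VirtualRepresentation G
    U ⊖ U′ = U ⊕ (ℤ.- (+ 1)) · U′

    _ℤ·_ : ℤ → A → A
    (+ m)    ℤ· r = m ℕ· r
    -[1+ m ] ℤ· r = - (suc m ℕ· r)

    χ : VirtualRepresentation G → Group.Carrier G → A
    χ U x = foldr (λ (a , W) s → a ℤ· trace (Representation.ρ W x) + s) 0# U

  module _ {k : ℕ} (n : Fin k → ℕ) where

    ∏GL : Group (r ⊔ ℓ) ℓ
    ∏GL = ∏-group (λ i → GL (n i))

    fundamental : Fin k → Representation ∏GL
    fundamental i = record
      { dim   = n i
      ; ρ     = λ g → Unit.value (g i)
      ; isHom = record
          { isMagmaHomomorphism = record
              { isRelHomomorphism = record { cong = λ g≈h → g≈h i }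
              ; homo = λ _ _ _ _ → ≈-refl
              }
          ; ε-homo = λ _ _ → ≈-refl
          }
      }

module Cyclic (k : ℕ) .{{_ : NonZero k}} where

  -- The index 1, the indices 1, …, k being represented by 0, …, k - 1.
  first : Fin k
  first = 0 mod k

  next : Fin k → Fin k
  next i = suc (toℕ i) mod k

  prev : Fin k → Fin k
  prev i = (toℕ i ℕ.+ pred k) mod k

  next^ : ℕ → Fin k → Fin k
  next^ zero    i = i
  next^ (suc m) i = next (next^ m i)

  toℕ-mod : ∀ a → toℕ (a mod k) ≡ a % k
  toℕ-mod a = Fin.toℕ-fromℕ< _

  suc-% : ∀ a → suc (a % k) % k ≡ suc a % k
  suc-% a = begin
    suc (a % k) % k               ≡⟨ %-distribˡ-+ 1 (a % k) k ⟩
    (1 % k ℕ.+ a % k % k) % k     ≡⟨ cong (λ z → (1 % k ℕ.+ z) % k) (m%n%n≡m%n a k) ⟩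
    (1 % k ℕ.+ a % k) % k         ≡⟨ %-distribˡ-+ 1 a k ⟨
    suc a % k                     ∎
    where open ≡-Reasoning

  toℕ-next^ : ∀ m i → toℕ (next^ m i) ≡ (toℕ i ℕ.+ m) % k
  toℕ-next^ zero i =
    sym (trans (cong (_% k) (ℕ.+-identityʳ (toℕ i))) (m<n⇒m%n≡m (Fin.toℕ<n i)))
  toℕ-next^ (suc m) i = begin
    toℕ (suc (toℕ (next^ m i)) mod k)  ≡⟨ toℕ-mod _ ⟩
    suc (toℕ (next^ m i)) % k          ≡⟨ cong (λ z → suc z % k) (toℕ-next^ m i) ⟩
    suc ((toℕ i ℕ.+ m) % k) % k        ≡⟨ suc-% (toℕ i ℕ.+ m) ⟩
    suc (toℕ i ℕ.+ m) % k              ≡⟨ cong (_% k) (ℕ.+-suc (toℕ i) m) ⟨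
    (toℕ i ℕ.+ suc m) % k              ∎
    where open ≡-Reasoning

  next^-k : ∀ i → next^ k i ≡ i
  next^-k i = Fin.toℕ-injective (begin
    toℕ (next^ k i)      ≡⟨ toℕ-next^ k i ⟩
    (toℕ i ℕ.+ k) % k    ≡⟨ [m+n]%n≡m%n (toℕ i) k ⟩
    toℕ i % k            ≡⟨ m<n⇒m%n≡m (Fin.toℕ<n i) ⟩
    toℕ i                ∎)
    where open ≡-Reasoning

  module _ {a : Level} (X : Fin k → Set a) where

    Tuple : Set a
    Tuple = ∀ i → X i → X (next i)

    path : Tuple → ∀ m {i} → X i → X (next^ m i)
    path f zero    v = v
    path f (suc m) v = f _ (path f m v)

    -- f_k ⋯ f_1 : X_1 → X_1, transported along next^ k first ≡ first.
    composite : Tuple → X first → X first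
    composite f v = subst X (next^-k first) (path f k v)

Constant : ∀ {a b} {A : Set a} {B : Set b} → (A → B) → Set (a ⊔ b)
Constant h = ∃[ c ] ∀ v → h v ≡ c

EventuallyConstant : ∀ {a} {A : Set a} → (A → A) → Set a
EventuallyConstant {A = A} h = ∃[ m ] 1 ≤ m × Constant (h ^ m)
  where open Endo A using (_^_)

module _ {a : Level} {A : Set a} {n : ℕ} (enum : A ↔ Fin n) where
  open Inverse enum
  open Endo A using (_^_; ^-homo)

  private
    to-injective : ∀ {u v} → to u ≡ to v → u ≡ v
    to-injective {u} {v} e =
      trans (sym (strictlyInverseʳ u)) (trans (cong from e) (strictlyInverseʳ v))

    constant? : (h : A → A) → Dec (Constant h)
    constant? h = map′
      (λ (i , p) → from i , λ v →
        to-injective (trans (cong (to ∘ h) (sym (strictlyInverseʳ v)))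
          (trans (p (to v)) (sym (strictlyInverseˡ i)))))
      (λ (c , p) → to c , λ j → cong to (p (from j)))
      (Fin.any? (λ i → Fin.all? (λ j → to (h (from j)) Fin.≟ i)))

    -- By the pigeonhole principle two of the first n ^ n + 1 powers of h agree, so if
    -- any power of h is constant, then so is h ^ (n ^ n).
    bound : ℕ
    bound = n ℕ.^ n

    later : ∀ (h : A → A) m l → Constant (h ^ m) → Constant (h ^ (m ℕ.+ l))
    later h m l (c , p) = c , λ v → trans (cong (λ q → q v) (^-homo h m l)) (p ((h ^ l) v))

    code : (h : A → A) → Fin (suc bound) → Fin bound
    code h i = funToFin (λ j → to ((h ^ toℕ i) (from j)))

    code-≗ : ∀ h i j → code h i ≡ code h j → h ^ toℕ i ≗ h ^ toℕ j
    code-≗ h i j e v = to-injective (begin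
      to ((h ^ toℕ i) v)                 ≡⟨ cong (to ∘ (h ^ toℕ i)) (strictlyInverseʳ v) ⟨
      to ((h ^ toℕ i) (from (to v)))     ≡⟨ Fin.finToFun-funToFin _ (to v) ⟨
      finToFun (code h i) (to v)         ≡⟨ cong (λ z → finToFun z (to v)) e ⟩
      finToFun (code h j) (to v)         ≡⟨ Fin.finToFun-funToFin _ (to v) ⟩
      to ((h ^ toℕ j) (from (to v)))     ≡⟨ cong (to ∘ (h ^ toℕ j)) (strictlyInverseʳ v) ⟩
      to ((h ^ toℕ j) v)                 ∎)
      where open ≡-Reasoning

    shift : ∀ h p d → h ^ (d ℕ.+ p) ≗ h ^ p → ∀ t → h ^ (t ℕ.* d ℕ.+ p) ≗ h ^ p
    shift h p d e zero    v = refl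
    shift h p d e (suc t) v = begin
      (h ^ (d ℕ.+ t ℕ.* d ℕ.+ p)) v      ≡⟨ cong (λ z → (h ^ z) v) (ℕ.+-assoc d (t ℕ.* d) p) ⟩
      (h ^ (d ℕ.+ (t ℕ.* d ℕ.+ p))) v    ≡⟨ cong (λ q → q v) (^-homo h d (t ℕ.* d ℕ.+ p)) ⟩
      (h ^ d) ((h ^ (t ℕ.* d ℕ.+ p)) v)  ≡⟨ cong (h ^ d) (shift h p d e t v) ⟩
      (h ^ d) ((h ^ p) v)                ≡⟨ cong (λ q → q v) (^-homo h d p) ⟨
      (h ^ (d ℕ.+ p)) v                  ≡⟨ e v ⟩
      (h ^ p) v                          ∎
      where open ≡-Reasoning

    constant-bound : ∀ h m → Constant (h ^ m) → Constant (h ^ bound)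
    constant-bound h m hm
      with i , j , i<j , e ← Fin.pigeonhole (ℕ.n<1+n bound) (code h)
      = subst (λ z → Constant (h ^ z)) (ℕ.m+[n∸m]≡n p≤bound)
          (later h p (bound ℕ.∸ p) hp)
      where
      p = toℕ i
      d = toℕ j ℕ.∸ p
      p≤bound : p ≤ bound
      p≤bound = ℕ.≤-pred (Fin.toℕ<n i)
      d+p≡j : d ℕ.+ p ≡ toℕ j
      d+p≡j = ℕ.m∸n+n≡m (ℕ.<⇒≤ i<j)
      1≤d : 1 ≤ d
      1≤d = ℕ.m<n⇒0<n∸m i<j
      big : m ≤ m ℕ.* d ℕ.+ p
      big = ℕ.≤-trans (ℕ.≤-reflexive (sym (ℕ.*-identityʳ m)))
              (ℕ.≤-trans (ℕ.*-monoʳ-≤ m 1≤d) (ℕ.m≤m+n (m ℕ.* d) p))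
      hbig : Constant (h ^ (m ℕ.* d ℕ.+ p))
      hbig = subst (λ z → Constant (h ^ z)) (ℕ.m+[n∸m]≡n big) (later h m _ hm)
      periodic : h ^ (d ℕ.+ p) ≗ h ^ p
      periodic v = trans (cong (λ z → (h ^ z) v) d+p≡j) (sym (code-≗ h i j e v))
      hp : Constant (h ^ p)
      hp = proj₁ hbig , λ v → trans (sym (shift h p d periodic m v)) (proj₂ hbig v)

  eventuallyConstant? : (h : A → A) → Dec (EventuallyConstant h)
  eventuallyConstant? h = map′
    (λ p → suc bound , s≤s z≤n ,
      subst (λ z → Constant (h ^ z)) (ℕ.+-comm bound 1) (later h bound 1 p))
    (λ (m , _ , p) → constant-bound h m p)
    (constant? (h ^ bound))

-- All dependent functions with values in the given lists, one for each choice of values.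
choices : ∀ {m b} {B : Fin m → Set b} → (∀ i → List (B i)) → List (∀ i → B i)
choices {zero}          bs = (λ ()) ∷ []
choices {suc m} {B = B} bs = cartesianProductWith cons (bs zero) (choices (bs ∘ suc))
  where
  cons : B zero → (∀ i → B (suc i)) → ∀ i → B i
  cons b f zero    = b
  cons b f (suc i) = f i

module Tuples
  {a : Level} (k : ℕ) .{{_ : NonZero k}}
  (X : Fin k → Set a) (n : Fin k → ℕ) (enum : ∀ i → X i ↔ Fin (n i))
  where
  open Cyclic k

  element : ∀ i → Fin (n i) → X i
  element i = Inverse.from (enum i)

  -- Every tuple of maps occurs exactly once, up to pointwise equality.
  tuples : List (Tuple X)
  tuples = choices (λ i →
    map (_∘ Inverse.to (enum i)) (choices {n i} (λ _ → tabulate (element (next i)))))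

  EC : Tuple X → Set a
  EC f = EventuallyConstant (composite X f)

  EC? : ∀ f → Dec (EC f)
  EC? f = eventuallyConstant? (enum first) (composite X f)

  module _ {c ℓ : Level} (R : CommutativeRing c ℓ) where
    -- There is one variable x i v for each element (i , v) of the disjoint union of the X i;
    -- x assigns a value in R to each of them.
    open CommutativeRing R using (Carrier; _+_; 0#; *-commutativeMonoid)
    open Algebra.Properties.CommutativeMonoid.Sum *-commutativeMonoid
      using () renaming (sum to ∏)

    weight : (∀ i → X i → Carrier) → Tuple X → Carrier
    weight x f = ∏ (λ i → ∏ (λ v → x (next i) (f i (element i v))))

    P : (∀ i → X i → Carrier) → Carrier
    P x = foldr _+_ 0# (map (weight x) (filter EC? tuples))

{-# OPTIONS --safe #-}

-- Give f the weight w(f), and write p_i and q_i for the sums of x_v and of x_v² over X_i.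
-- The claim is that the tuples which are not eventually constant have total weight
-- ∏_i p_{i+1}^(n_i - 2) (p_{i+1}² - q_{i+1}).
--
-- Fix f_2, …, f_k and put l = f_k ⋯ f_2.  The values of f_1 are independent, so l f_1 is a
-- random endofunction of X_1 with independent values.  It is eventually constant iff it is a
-- tree rooted at its only fixed point, and summing over the root (Cayley's formula) gives
-- p_2^(n_1 - 2) ∑ x_a x_b over the a, b in X_2 with l a ≠ l b for the other endofunctions.
-- If a ≠ b then f_2 a and f_2 b are again two independent points, now of X_3, so summing over
-- f_2, …, f_k in turn splits off one factor p_{i+1}^(n_i - 2) (p_i² - q_i) at a time.
--
-- Cayley's formula itself, with the vertices weighted, follows by contracting one vertex into
-- the vertex it points to: this leaves the total weight unchanged and increases the weight of
-- the root by that of the contracted vertex if it pointed to the root.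
module Submission where

open import Algebra.Bundles using (CommutativeRing; Group)
import Algebra.Properties.CommutativeMonoid.Sum
import Algebra.Properties.Monoid.Mult
import Algebra.Properties.Semiring.Exp
import Algebra.Properties.Semiring.Mult
import Algebra.Properties.Semiring.Sum
import Algebra.Solver.CommutativeMonoid
open import Data.Bool.Base using (if_then_else_)
open import Data.Fin.Base using (Fin; zero; suc; toℕ; punchIn; punchOut)
open import Data.Fin.Permutation using (Permutation; permutation)
import Data.Fin.Properties as Fin
open import Data.Integer.Base as ℤ using (ℤ; +_)
import Data.Integer.Properties as ℤ
open import Data.List.Base
  using (List; []; _∷_; _++_; map; foldr; filter; tabulate; cartesianProductWith)
open import Data.Maybe.Base using (Maybe; just; nothing)
open import Data.Nat.Base as ℕ using (ℕ; zero; suc; _∸_; s≤s; z≤n; NonZero)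
open import Data.Nat.DivMod
  using (_%_; _mod_; n%n≡0; m<n⇒m%n≡m; %-distribˡ-+; m%n%n≡m%n; [m+n]%n≡m%n)
import Data.Nat.Properties as ℕ
open import Data.Product.Base using (∃-syntax; _×_; _,_; proj₁; proj₂; Σ)
open import Data.Vec.Base using (Vec; []; _∷_; lookup; insertAt)
open import Data.Vec.Properties using (insertAt-lookup; insertAt-punchIn)
open import Function.Base using (_∘_)
open import Function.Bundles using (_⇔_; mk⇔; Equivalence; _↔_; Inverse)
import Function.Endo.Propositional as Endo
open import Relation.Binary.PropositionalEquality
  using (_≡_; _≢_; _≗_; refl; cong; cong₂; subst; module ≡-Reasoning)
import Relation.Binary.PropositionalEquality as ≡
import Relation.Binary.Reasoning.Setoid
open import Relation.Nullary using (Dec; yes; no; does; contradiction; ¬_)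
open import Relation.Nullary.Decidable using (map′; ¬?)
open import Relation.Unary using (Pred; Decidable)
open import Defs

-- Sums over maps

module Enumeration {r ℓ} (R : CommutativeRing r ℓ) where
  open CommutativeRing R
    renaming (Carrier to A; refl to ≈-refl; sym to ≈-sym; trans to ≈-trans)
    hiding (zero)
  open Algebra.Properties.Semiring.Sum semiring public
  open Algebra.Properties.Semiring.Exp semiring public using (_^_; ^-congˡ)
  module ∏ = Algebra.Properties.CommutativeMonoid.Sum *-commutativeMonoid
  module *-Solver = Algebra.Solver.CommutativeMonoid *-commutativeMonoid
  open Relation.Binary.Reasoning.Setoid setoid

  ∏ : ∀ {n} → (Fin n → A) → A
  ∏ = ∏.sum

  x*yz≈y*xz : ∀ x y z → x * (y * z) ≈ y * (x * z)
  x*yz≈y*xz = solve 3 (λ x y z → x ⊕ (y ⊕ z) ⊜ y ⊕ (x ⊕ z)) ≈-refl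
    where open *-Solver

  indicator : ∀ {p} {P : Set p} → Dec P → A
  indicator d = if does d then 1# else 0#

  indicator-yes : ∀ {p} {P : Set p} (d : Dec P) → P → indicator d ≈ 1#
  indicator-yes (yes _) p = ≈-refl
  indicator-yes (no ¬p) p = contradiction p ¬p

  indicator-no : ∀ {p} {P : Set p} (d : Dec P) → ¬ P → indicator d ≈ 0#
  indicator-no (yes p) ¬p = contradiction p ¬p
  indicator-no (no _)  ¬p = ≈-refl

  indicator-⇔ : ∀ {p q} {P : Set p} {Q : Set q} (d : Dec P) (e : Dec Q) →
                P ⇔ Q → indicator d ≈ indicator e
  indicator-⇔ (yes p) e P⇔Q = ≈-sym (indicator-yes e (Equivalence.to P⇔Q p))
  indicator-⇔ (no ¬p) e P⇔Q = ≈-sym (indicator-no e (¬p ∘ Equivalence.from P⇔Q))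

  indicator-¬ : ∀ {p} {P : Set p} (d : Dec P) → indicator d + indicator (¬? d) ≈ 1#
  indicator-¬ (yes _) = +-identityʳ 1#
  indicator-¬ (no _)  = +-identityˡ 1#

  sum-zero : ∀ {n} {t : Fin n → A} → (∀ i → t i ≈ 0#) → sum t ≈ 0#
  sum-zero {n} t≈0 = ≈-trans (sum-cong-≋ t≈0) (sum-replicate-zero n)

  sum-indicator : ∀ {n} (i : Fin n) (t : Fin n → A) →
                  ∑[ j < n ] (indicator (i Fin.≟ j) * t j) ≈ t i
  sum-indicator zero t = ≈-trans
    (+-cong (*-identityˡ _) (sum-zero (λ j → zeroˡ (t (suc j))))) (+-identityʳ _)
  sum-indicator (suc i) t = ≈-trans
    (+-cong (zeroˡ _) (sum-indicator i (t ∘ suc))) (+-identityˡ _)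

  -- A map Fin n → Fin m is represented by a vector, so that the laws below put no
  -- extensionality condition on φ.
  sumᵛ : ∀ n {m} → (Vec (Fin m) n → A) → A
  sumᵛ zero        φ = φ []
  sumᵛ (suc n) {m} φ = ∑[ u < m ] sumᵛ n (λ h → φ (u ∷ h))

  sumᵛ-cong : ∀ n {m} {φ ψ : Vec (Fin m) n → A} →
              (∀ h → φ h ≈ ψ h) → sumᵛ n φ ≈ sumᵛ n ψ
  sumᵛ-cong zero    e = e []
  sumᵛ-cong (suc n) e = sum-cong-≋ (λ u → sumᵛ-cong n (λ h → e (u ∷ h)))

  sumᵛ-zero : ∀ n {m} {φ : Vec (Fin m) n → A} → (∀ h → φ h ≈ 0#) → sumᵛ n φ ≈ 0#
  sumᵛ-zero zero    φ≈0 = φ≈0 []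
  sumᵛ-zero (suc n) φ≈0 = sum-zero (λ u → sumᵛ-zero n (λ h → φ≈0 (u ∷ h)))

  sumᵛ-*ˡ : ∀ n {m} c (φ : Vec (Fin m) n → A) → c * sumᵛ n φ ≈ sumᵛ n (λ h → c * φ h)
  sumᵛ-*ˡ zero    c φ = ≈-refl
  sumᵛ-*ˡ (suc n) c φ = ≈-trans (*-distribˡ-sum c (λ u → sumᵛ n (λ h → φ (u ∷ h))))
    (sum-cong-≋ (λ u → sumᵛ-*ˡ n c (λ h → φ (u ∷ h))))

  sumᵛ-*ʳ : ∀ n {m} c (φ : Vec (Fin m) n → A) → sumᵛ n φ * c ≈ sumᵛ n (λ h → φ h * c)
  sumᵛ-*ʳ n c φ = ≈-trans (*-comm _ c)
    (≈-trans (sumᵛ-*ˡ n c φ) (sumᵛ-cong n (λ h → *-comm c (φ h))))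

  sumᵛ-∑-comm : ∀ n {m l} (φ : Vec (Fin m) n → Fin l → A) →
    sumᵛ n (λ h → ∑[ i < l ] φ h i) ≈ ∑[ i < l ] sumᵛ n (λ h → φ h i)
  sumᵛ-∑-comm zero    φ = ≈-refl
  sumᵛ-∑-comm (suc n) φ = ≈-trans
    (sum-cong-≋ (λ u → sumᵛ-∑-comm n (λ h → φ (u ∷ h))))
    (∑-comm (λ u i → sumᵛ n (λ h → φ (u ∷ h) i)))

  -- Exchanging finite sums brings any coordinate `i` to the outside, so that a chosen point can be
  -- treated separately.
  sumᵛ-insertAt : ∀ n {m} (φ : Vec (Fin m) (suc n) → A) (i : Fin (suc n)) →
    sumᵛ (suc n) φ ≈ ∑[ u < m ] sumᵛ n (λ h → φ (insertAt h i u))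
  sumᵛ-insertAt n       φ zero    = ≈-refl
  sumᵛ-insertAt (suc n) φ (suc i) = ≈-trans
    (sum-cong-≋ (λ u → sumᵛ-insertAt n (λ h → φ (u ∷ h)) i))
    (∑-comm (λ u u′ → sumᵛ n (λ h → φ (u ∷ insertAt h i u′))))

  weightᵛ : ∀ {n m} → (Fin m → A) → Vec (Fin m) n → A
  weightᵛ x h = ∏ (λ v → x (lookup h v))

  weightᵛ-insertAt : ∀ {n m} (x : Fin m → A) (h : Vec (Fin m) n) i u →
                     weightᵛ x (insertAt h i u) ≈ x u * weightᵛ x h
  weightᵛ-insertAt x h        zero    u = ≈-refl
  weightᵛ-insertAt x (u′ ∷ h) (suc i) u = ≈-trans
    (*-congˡ (weightᵛ-insertAt x h i u)) (x*yz≈y*xz _ _ _)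

  sumᵛ-weightᵛ : ∀ n {m} (x : Fin m → A) → sumᵛ n (weightᵛ x) ≈ sum x ^ n
  sumᵛ-weightᵛ zero    x = ≈-refl
  sumᵛ-weightᵛ (suc n) x = begin
    ∑[ u < _ ] sumᵛ n (λ h → x u * weightᵛ x h)
      ≈⟨ sum-cong-≋ (λ u → sumᵛ-*ˡ n (x u) (weightᵛ x)) ⟨
    ∑[ u < _ ] (x u * sumᵛ n (weightᵛ x))
      ≈⟨ *-distribʳ-sum (sumᵛ n (weightᵛ x)) x ⟨
    sum x * sumᵛ n (weightᵛ x)
      ≈⟨ *-congˡ (sumᵛ-weightᵛ n x) ⟩
    sum x * sum x ^ n ∎

  -- Two distinct coordinates of a random map are independent.
  sumᵛ-two-points : ∀ n {m} (x : Fin m → A) (a b : Fin n) → a ≢ b →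
    (φ : Fin m → Fin m → A) →
    sumᵛ n (λ h → weightᵛ x h * φ (lookup h a) (lookup h b)) ≈
    sum x ^ (n ∸ 2) * ∑[ s < m ] ∑[ t < m ] (x s * x t * φ s t)
  sumᵛ-two-points (suc zero) x zero zero a≢b φ = contradiction refl a≢b
  sumᵛ-two-points (suc (suc n)) {m} x a b a≢b φ = begin
    sumᵛ (2 ℕ.+ n) ψ
      ≈⟨ sumᵛ-insertAt (suc n) ψ a ⟩
    ∑[ s < m ] sumᵛ (suc n) (λ h → ψ (insertAt h a s))
      ≈⟨ sum-cong-≋ (λ s → sumᵛ-insertAt n (λ h → ψ (insertAt h a s)) b′) ⟩
    ∑[ s < m ] ∑[ t < m ] sumᵛ n (λ h → ψ (insertAt (insertAt h b′ t) a s))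
      ≈⟨ sum-cong-≋ (λ s → sum-cong-≋ (λ t → sumᵛ-cong n (λ h → value s t h))) ⟩
    ∑[ s < m ] ∑[ t < m ] sumᵛ n (λ h → (x s * x t * φ s t) * weightᵛ x h)
      ≈⟨ sum-cong-≋ (λ s → sum-cong-≋ (λ t → ≈-trans
           (≈-sym (sumᵛ-*ˡ n (x s * x t * φ s t) (weightᵛ x)))
           (≈-trans (*-congˡ (sumᵛ-weightᵛ n x)) (*-comm _ _)))) ⟩
    ∑[ s < m ] ∑[ t < m ] (sum x ^ n * (x s * x t * φ s t))
      ≈⟨ sum-cong-≋ (λ s → *-distribˡ-sum (sum x ^ n) (λ t → x s * x t * φ s t)) ⟨
    ∑[ s < m ] (sum x ^ n * ∑[ t < m ] (x s * x t * φ s t))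
      ≈⟨ *-distribˡ-sum (sum x ^ n) (λ s → ∑[ t < m ] (x s * x t * φ s t)) ⟨
    sum x ^ n * ∑[ s < m ] ∑[ t < m ] (x s * x t * φ s t) ∎
    where
    ψ : Vec (Fin m) (2 ℕ.+ n) → A
    ψ h = weightᵛ x h * φ (lookup h a) (lookup h b)
    -- Once the coordinate `a` is taken out, `b` is found at position `punchOut a≢b` among the
    -- remaining ones.
    b′ = punchOut a≢b
    b-value : ∀ s t h → lookup (insertAt (insertAt h b′ t) a s) b ≡ t
    b-value s t h = ≡.trans
      (cong (lookup (insertAt (insertAt h b′ t) a s)) (≡.sym (Fin.punchIn-punchOut a≢b)))
      (≡.trans (insertAt-punchIn (insertAt h b′ t) a s b′) (insertAt-lookup h b′ t))
    value : ∀ s t h → ψ (insertAt (insertAt h b′ t) a s) ≈ (x s * x t * φ s t) * weightᵛ x h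
    value s t h = begin
      ψ (insertAt (insertAt h b′ t) a s)
        ≈⟨ *-cong
             (≈-trans (weightᵛ-insertAt x (insertAt h b′ t) a s)
                      (*-congˡ (weightᵛ-insertAt x h b′ t)))
             (reflexive (≡.cong₂ φ (insertAt-lookup (insertAt h b′ t) a s) (b-value s t h))) ⟩
      (x s * (x t * weightᵛ x h)) * φ s t
        ≈⟨ solve 4 (λ p q w f → (p ⊕ (q ⊕ w)) ⊕ f ⊜ ((p ⊕ q) ⊕ f) ⊕ w) ≈-refl
             (x s) (x t) (weightᵛ x h) (φ s t) ⟩
      (x s * x t * φ s t) * weightᵛ x h ∎
      where open *-Solver

-- Rooted forests

-- A derivation is a finite walk along `g` that ends at the root, so the inductive definition
-- excludes cycles by itself.
data Drains {n} (g : Fin n → Maybe (Fin n)) : Maybe (Fin n) → Set where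
  root : Drains g nothing
  step : ∀ {v} → Drains g (g v) → Drains g (just v)

-- nothing stands for the root.
IsForest : ∀ {n} → (Fin n → Maybe (Fin n)) → Set
IsForest g = ∀ v → Drains g (just v)

-- The value at just zero is junk.
lower : ∀ {n} → Maybe (Fin (suc n)) → Maybe (Fin n)
lower nothing        = nothing
lower (just zero)    = nothing
lower (just (suc v)) = just v

-- Here `c` is meant to be the arrow of the vertex `zero`: arrows into `zero` are redirected to
-- where `zero` points, and the other vertices are renumbered.
contract : ∀ {n} → Maybe (Fin (suc n)) → Maybe (Fin (suc n)) → Maybe (Fin n)
contract c nothing        = nothing
contract c (just zero)    = lower c
contract c (just (suc v)) = just v

-- A derivation at a loop has a shorter derivation at the same vertex inside it, which is an
-- infinite descent.
loop-not-forest : ∀ {n} {g : Fin (suc n) → Maybe (Fin (suc n))} →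
                  g zero ≡ just zero → ¬ IsForest g
loop-not-forest {g = g} loop F = absurd (F zero) refl
  where
  absurd : ∀ {w} → Drains g w → w ≢ just zero
  absurd (step D) refl = absurd D loop

module _ {n} (g : Fin (suc n) → Maybe (Fin (suc n))) (noloop : g zero ≢ just zero) where
  private
    g′ : Fin n → Maybe (Fin n)
    g′ = contract (g zero) ∘ g ∘ suc

    contract-self : ∀ (c : Maybe (Fin (suc n))) → c ≢ just zero → contract c c ≡ lower c
    contract-self nothing        _  = refl
    contract-self (just zero)    c≢ = contradiction refl c≢
    contract-self (just (suc v)) _  = refl

    down : ∀ {w} → Drains g w → Drains g′ (contract (g zero) w)
    down root               = root
    down (step {zero} D)    = subst (Drains g′) (contract-self (g zero) noloop) (down D)
    down (step {suc v} D)   = step (down D)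

    -- Passing through `zero` consumes no step of the derivation in `g′`. `up-low` is the state just
    -- after such a passage, which cannot recur at once since `zero` is not a loop; this makes the
    -- recursion terminate.
    up     : ∀ {w′} → Drains g′ w′ → ∀ w → contract (g zero) w ≡ w′ → Drains g w
    up-low : ∀ {w′} → Drains g′ w′ → ∀ w → w ≢ just zero → lower w ≡ w′ → Drains g w
    up D        nothing        e    = root
    up D        (just zero)    e    = step (up-low D (g zero) noloop e)
    up (step D) (just (suc v)) refl = step (up D _ refl)
    up-low D        nothing        _  e    = root
    up-low D        (just zero)    w≢ e    = contradiction refl w≢
    up-low (step D) (just (suc v)) _  refl = step (up D _ refl)

  -- A walk that visits `zero` goes on to `g zero`, which is another vertex or the root; leaving out
  -- such visits or putting them back does not affect whether the walk ends.
  contract-forest : IsForest g ⇔ IsForest g′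
  contract-forest = mk⇔ (λ F v → down (F (suc v))) from
    where
    from : IsForest g′ → IsForest g
    from F zero    = drain (contract (g zero) (just zero)) refl
      where
      drain : ∀ w′ → contract (g zero) (just zero) ≡ w′ → Drains g (just zero)
      drain nothing  e = up root (just zero) e
      drain (just v) e = up (F v) (just zero) e
    from F (suc v) = up (F v) (just (suc v)) refl

-- The weighted Cayley formula

module Forests {r ℓ} (R : CommutativeRing r ℓ) where
  open CommutativeRing R
    renaming (Carrier to A; refl to ≈-refl; sym to ≈-sym; trans to ≈-trans)
    hiding (zero)
  open Enumeration R
  open Relation.Binary.Reasoning.Setoid setoid

  atRoot : ∀ {n} → Maybe (Fin n) → A
  atRoot nothing  = 1#
  atRoot (just _) = 0#

  atFirst offFirst : ∀ {n} → Maybe (Fin (suc n)) → A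
  atFirst nothing        = 0#
  atFirst (just zero)    = 1#
  atFirst (just (suc _)) = 0#
  offFirst nothing        = 1#
  offFirst (just zero)    = 0#
  offFirst (just (suc _)) = 1#

  module _ {m} (x : Fin m → A) where

    -- The values `a` carry the weights, and the labelling `l` tells which vertex, or the root, each
    -- value stands for. A contraction then changes only `l` and leaves `x` alone.
    rootWeight : ∀ {n} → (Fin m → Maybe (Fin n)) → A
    rootWeight l = ∑[ a < m ] (x a * atRoot (l a))

    private
      first-weights : ∀ {n} (l : Fin m → Maybe (Fin (suc n))) →
        ∑[ a < m ] (x a * offFirst (l a)) + ∑[ a < m ] (x a * atFirst (l a)) ≈ sum x
      first-weights l = ≈-trans
        (≈-sym (∑-distrib-+ (λ a → x a * offFirst (l a)) (λ a → x a * atFirst (l a))))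
        (sum-cong-≋ (λ a → ≈-trans (≈-sym (distribˡ _ _ _))
          (≈-trans (*-congˡ (split (l a))) (*-identityʳ _))))
        where
        split : ∀ {n} (c : Maybe (Fin (suc n))) → offFirst c + atFirst c ≈ 1#
        split nothing        = +-identityʳ _
        split (just zero)    = +-identityˡ _
        split (just (suc v)) = +-identityʳ _

      -- If `c` is the root, the values standing for the first vertex come to stand for the root;
      -- otherwise no value does so anew.
      rootWeight-contract : ∀ {n} (l : Fin m → Maybe (Fin (suc n))) c → c ≢ just zero →
        rootWeight (contract c ∘ l) ≈
        rootWeight l + atRoot c * ∑[ a < m ] (x a * atFirst (l a))
      rootWeight-contract l c c≢ = ≈-trans
        (sum-cong-≋ (λ a → ≈-trans (*-congˡ (value c c≢ (l a)))
          (≈-trans (distribˡ _ _ _) (+-congˡ (x*yz≈y*xz _ _ _)))))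
        (≈-trans (∑-distrib-+ (λ a → x a * atRoot (l a)) (λ a → atRoot c * (x a * atFirst (l a))))
          (+-congˡ (≈-sym (*-distribˡ-sum (atRoot c) (λ a → x a * atFirst (l a))))))
        where
        value : ∀ {n} c → c ≢ just zero → (w : Maybe (Fin (suc n))) →
                atRoot (contract c w) ≈ atRoot w + atRoot c * atFirst w
        value c              _  nothing        = ≈-sym (≈-trans (+-congˡ (zeroʳ _)) (+-identityʳ _))
        value c              _  (just (suc v)) = ≈-sym (≈-trans (+-congˡ (zeroʳ _)) (+-identityʳ _))
        value nothing        _  (just zero)    = ≈-sym (≈-trans (+-identityˡ _) (*-identityʳ _))
        value (just zero)    c≢ (just zero)    = contradiction refl c≢
        value (just (suc u)) _  (just zero)    = ≈-sym (≈-trans (+-identityˡ _) (*-identityʳ _))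

    -- Cayley's formula, by induction on the number of vertices. Let `y`, `z`, `o` be the weights of
    -- the values labelled by the root, by the first vertex, and by anything but the first vertex.
    -- Summing over the arrow of the first vertex gives `o * y + y * z`, that is `y * (o + z)`, and
    -- `o + z` is the whole weight. The decision procedure is a parameter because it is transported
    -- along each contraction.
    forest-sum : ∀ n (l : Fin m → Maybe (Fin (suc n)))
      (forest? : ∀ (h : Vec (Fin m) (suc n)) → Dec (IsForest (l ∘ lookup h))) →
      sumᵛ (suc n) (λ h → weightᵛ x h * indicator (forest? h)) ≈ rootWeight l * sum x ^ n
    forest-sum zero l forest? =
      ≈-trans (sum-cong-≋ (λ a → *-cong (*-identityʳ _) (value a (l a) refl)))
              (≈-sym (*-identityʳ _))
      where
      value : ∀ a c → l a ≡ c → indicator (forest? (a ∷ [])) ≈ atRoot c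
      value a nothing e = indicator-yes (forest? (a ∷ []))
        (λ where zero → step (subst (Drains _) (≡.sym e) root))
      value a (just zero) e = indicator-no (forest? (a ∷ [])) (loop-not-forest e)
    -- Contract the first vertex into the vertex it points to.
    forest-sum (suc n) l forest? = begin
      ∑[ a < m ] sumᵛ (suc n) (λ h → x a * weightᵛ x h * indicator (forest? (a ∷ h)))
        ≈⟨ sum-cong-≋ (λ a → ≈-trans
             (sumᵛ-cong (suc n) (λ h → *-assoc (x a) (weightᵛ x h) (indicator (forest? (a ∷ h)))))
             (≈-trans (≈-sym (sumᵛ-*ˡ (suc n) (x a) (λ h → weightᵛ x h * indicator (forest? (a ∷ h)))))
               (*-congˡ (inner a (l a) refl)))) ⟩
      ∑[ a < m ] (x a * (offFirst (l a) * (y * p) + atRoot (l a) * (z * p)))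
        ≈⟨ sum-cong-≋ (λ a → ≈-trans (distribˡ (x a) (offFirst (l a) * (y * p)) (atRoot (l a) * (z * p)))
             (≈-sym (+-cong (*-assoc (x a) (offFirst (l a)) (y * p)) (*-assoc (x a) (atRoot (l a)) (z * p))))) ⟩
      ∑[ a < m ] (x a * offFirst (l a) * (y * p) + x a * atRoot (l a) * (z * p))
        ≈⟨ ∑-distrib-+ (λ a → x a * offFirst (l a) * (y * p)) (λ a → x a * atRoot (l a) * (z * p)) ⟩
      ∑[ a < m ] (x a * offFirst (l a) * (y * p)) + ∑[ a < m ] (x a * atRoot (l a) * (z * p))
        ≈⟨ +-cong (*-distribʳ-sum (y * p) (λ a → x a * offFirst (l a)))
                  (*-distribʳ-sum (z * p) (λ a → x a * atRoot (l a))) ⟨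
      o * (y * p) + y * (z * p)
        ≈⟨ +-cong (x*yz≈y*xz o y p) ≈-refl ⟩
      y * (o * p) + y * (z * p)
        ≈⟨ distribˡ y (o * p) (z * p) ⟨
      y * (o * p + z * p)
        ≈⟨ *-congˡ (≈-trans (≈-sym (distribʳ p o z)) (*-congʳ (first-weights l))) ⟩
      y * (sum x * p) ∎
      where
      p = sum x ^ n
      y = rootWeight l
      z = ∑[ a < m ] (x a * atFirst (l a))
      o = ∑[ a < m ] (x a * offFirst (l a))
      ψ : Fin m → Vec (Fin m) (suc n) → A
      ψ a h = weightᵛ x h * indicator (forest? (a ∷ h))
      contracted : ∀ a → l a ≢ just zero → sumᵛ (suc n) (ψ a) ≈ y * p + atRoot (l a) * (z * p)
      contracted a a≢ = ≈-trans
        (sumᵛ-cong (suc n) (λ h → *-congˡ {weightᵛ x h} (indicator-⇔ (forest? (a ∷ h)) (forest′? h)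
          (contract-forest (l ∘ lookup (a ∷ h)) a≢))))
        (≈-trans (forest-sum n (contract (l a) ∘ l) forest′?)
          (≈-trans (*-congʳ (rootWeight-contract l (l a) a≢))
            (≈-trans (distribʳ p y _) (+-congˡ (*-assoc _ _ _)))))
        where
        forest′? : ∀ h → Dec (IsForest (contract (l a) ∘ l ∘ lookup h))
        forest′? h = map′ (Equivalence.to eq) (Equivalence.from eq) (forest? (a ∷ h))
          where eq = contract-forest (l ∘ lookup (a ∷ h)) a≢
      inner : ∀ a c → l a ≡ c →
        sumᵛ (suc n) (ψ a) ≈ offFirst c * (y * p) + atRoot c * (z * p)
      inner a nothing e = ≈-trans (contracted a (λ e′ → contradiction (≡.trans (≡.sym e) e′) λ ()))
        (+-cong (≈-sym (*-identityˡ _)) (*-congʳ (reflexive (cong atRoot e))))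
      inner a (just (suc v)) e = ≈-trans (contracted a (λ e′ → contradiction (≡.trans (≡.sym e) e′) λ ()))
        (+-cong (≈-sym (*-identityˡ _)) (*-congʳ (reflexive (cong atRoot e))))
      inner a (just zero) e = ≈-trans
        (sumᵛ-zero (suc n) (λ h → ≈-trans
          (*-congˡ {weightᵛ x h} (indicator-no (forest? (a ∷ h)) (loop-not-forest e)))
          (zeroʳ (weightᵛ x h))))
        (≈-sym (≈-trans (+-cong (zeroˡ _) (zeroˡ _)) (+-identityˡ _)))

-- Eventually constant endofunctions

Drains-resp : ∀ {n} {g g′ : Fin n → Maybe (Fin n)} → g ≗ g′ → ∀ {w} → Drains g w → Drains g′ w
Drains-resp         e root     = root
Drains-resp {g′ = g′} e (step {v} D) = step (subst (Drains g′) (e v) (Drains-resp e D))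

-- Makes `r` the root and numbers the other points by the inverse of `punchIn r`.
label : ∀ {n} → Fin (suc n) → Fin (suc n) → Maybe (Fin n)
label r w with r Fin.≟ w
... | yes _  = nothing
... | no r≢w = just (punchOut r≢w)

label-self : ∀ {n} (r : Fin (suc n)) → label r r ≡ nothing
label-self r with r Fin.≟ r
... | yes _  = refl
... | no r≢r = contradiction refl r≢r

-- The individual bounds are added up, and upward closure in `m` carries each property to the total.
uniform-bound : ∀ {n} {P : Fin n → ℕ → Set} → (∀ i m l → P i m → P i (l ℕ.+ m)) →
                (∀ i → ∃[ m ] P i m) → ∃[ m ] ∀ i → P i m
uniform-bound {zero}      mono bound = 0 , λ ()
uniform-bound {suc n} {P} mono bound
  with m , p ← bound zero | l , q ← uniform-bound (λ i → mono (suc i)) (bound ∘ suc)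
  = l ℕ.+ m , λ where
      zero    → mono zero m l p
      (suc i) → subst (P (suc i)) (ℕ.+-comm m l) (mono (suc i) l m (q i))

module _ {a} {B : Set a} (e : B → B) where
  open Endo B using (_^_; ^-homo)

  ^-suc : ∀ m v → (e ^ suc m) v ≡ (e ^ m) (e v)
  ^-suc m v = ≡.trans (cong (λ l → (e ^ l) v) (ℕ.+-comm 1 m)) (cong (λ q → q v) (^-homo e m 1))

  ^-fixed : ∀ {r} → e r ≡ r → ∀ m → (e ^ m) r ≡ r
  ^-fixed er≡r zero    = refl
  ^-fixed er≡r (suc m) = ≡.trans (cong e (^-fixed er≡r m)) er≡r

  -- The power `e ^ m` takes the value `c` at `c` and at `e c`, and `e` commutes with its powers.
  limit-fixed : ∀ m ((c , _) : Constant (e ^ m)) → e c ≡ c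
  limit-fixed m (c , p) = begin
    e c            ≡⟨ cong e (p c) ⟨
    e ((e ^ m) c)  ≡⟨ ^-suc m c ⟩
    (e ^ m) (e c)  ≡⟨ p (e c) ⟩
    c              ∎
    where open ≡-Reasoning

  limit-unique : ∀ m ((c , _) : Constant (e ^ m)) {r} → e r ≡ r → c ≡ r
  limit-unique m (c , p) {r} er≡r = ≡.trans (≡.sym (p r)) (^-fixed er≡r m)

module _ {n} (e : Fin (suc n) → Fin (suc n)) {r} (er≡r : e r ≡ r) where
  open Endo (Fin (suc n)) using (_^_; ^-homo)

  private
    g : Fin n → Maybe (Fin n)
    g = label r ∘ e ∘ punchIn r

    drains : ∀ m w → (e ^ m) w ≡ r → Drains g (label r w)
    drains zero    w refl = subst (Drains g) (≡.sym (label-self r)) root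
    drains (suc m) w p with r Fin.≟ w
    ... | yes _  = root
    ... | no r≢w = step (subst (Drains g)
      (cong (label r ∘ e) (≡.sym (Fin.punchIn-punchOut r≢w)))
      (drains m (e w) (≡.trans (≡.sym (^-suc e m w)) p)))

    -- The index `w′` stays a variable, tied to `label r w` by an equation, so that the derivation
    -- can be matched.
    reaches : ∀ {w′} → Drains g w′ → ∀ w → w′ ≡ label r w → ∃[ m ] (e ^ m) w ≡ r
    reaches D w eq with r Fin.≟ w
    reaches D        w eq   | yes r≡w = 0 , ≡.sym r≡w
    reaches (step D) w refl | no r≢w
      with m , p ← reaches D (e w) (cong (label r ∘ e) (Fin.punchIn-punchOut r≢w))
      = suc m , ≡.trans (^-suc e m w) p

  -- An orbit that has reached the fixed point `r` stays there. Hence some power is constant as soon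
  -- as every orbit reaches `r`, the finitely many times having a common bound; conversely the
  -- constant value of a power can only be `r`.
  eventuallyConstant⇔isForest : EventuallyConstant e ⇔ IsForest g
  eventuallyConstant⇔isForest = mk⇔ to from
    where
    label-punchIn : ∀ v → label r (punchIn r v) ≡ just v
    label-punchIn v with r Fin.≟ punchIn r v
    ... | yes r≡ = contradiction (≡.sym r≡) (Fin.punchInᵢ≢i r v)
    ... | no r≢  = cong just (≡.trans (Fin.punchOut-cong r refl) (Fin.punchOut-punchIn r))
    to : EventuallyConstant e → IsForest g
    to (m , _ , c) v = subst (Drains g) (label-punchIn v)
      (drains m (punchIn r v) (≡.trans (proj₂ c _) (limit-unique e m c er≡r)))
    from : IsForest g → EventuallyConstant e
    from F = let m , p = uniform-bound mono (λ w → reach w (label r w) refl)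
             -- The extra application makes the exponent positive even if the common bound is `0`.
             in suc m , s≤s z≤n , r , λ w → ≡.trans (cong e (p w)) er≡r
      where
      mono : ∀ w m l → (e ^ m) w ≡ r → (e ^ (l ℕ.+ m)) w ≡ r
      mono w m l p = ≡.trans (cong (λ q → q w) (^-homo e l m))
        (≡.trans (cong (e ^ l) p) (^-fixed e er≡r l))
      reach : ∀ w w′ → label r w ≡ w′ → ∃[ m ] (e ^ m) w ≡ r
      reach w nothing  eq = reaches root w (≡.sym eq)
      reach w (just v) eq = reaches (F v) w (≡.sym eq)

-- The weight of the eventually constant endofunctions

module EndofunctionSum {r ℓ} (R : CommutativeRing r ℓ) where
  open CommutativeRing R
    renaming (Carrier to A; refl to ≈-refl; sym to ≈-sym; trans to ≈-trans)
    hiding (zero)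
  open Enumeration R
  open Forests R
  open Relation.Binary.Reasoning.Setoid setoid

  -- An eventually constant map has exactly one fixed point, its limit, so a sum over fixed points
  -- may be inserted freely.
  fixedPoint-sum : ∀ {n} (e : Fin n → Fin n) (ec? : Dec (EventuallyConstant e)) →
    ∑[ r < n ] (indicator (e r Fin.≟ r) * indicator ec?) ≈ indicator ec?
  fixedPoint-sum e (no _) = sum-zero (λ r → zeroʳ (indicator (e r Fin.≟ r)))
  fixedPoint-sum e (yes (m , _ , c)) = ≈-trans
    (sum-cong-≋ (λ r → *-congʳ (indicator-⇔ (e r Fin.≟ r) (proj₁ c Fin.≟ r)
      (mk⇔ (limit-unique e m c) (λ where refl → limit-fixed e m c)))))
    (sum-indicator (proj₁ c) (λ _ → 1#))

  atRoot-label : ∀ {n} (r w : Fin (suc n)) → atRoot (label r w) ≈ indicator (r Fin.≟ w)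
  atRoot-label r w with r Fin.≟ w
  ... | yes _ = ≈-refl
  ... | no _  = ≈-refl

  apart : ∀ {n} → Fin n → Fin n → A
  apart s t = indicator (¬? (s Fin.≟ t))

  module _ {m} (x : Fin m → A) where

    -- The maps with a prescribed value at the root r, all of whose other points drain to r,
    -- weighted by their values at the points other than r.
    rootedWeight : ∀ n → (Fin m → Fin (suc n)) → Fin (suc n) → A
    rootedWeight zero    l r = 1#
    rootedWeight (suc n) l r = ∑[ b < m ] (x b * indicator (r Fin.≟ l b)) * sum x ^ n

    -- Sending the point `l a` to the value `a` makes `l a` a fixed point of the endofunction. With
    -- it as the root, the values at the other points are counted by Cayley's formula.
    rooted-sum : ∀ n (l : Fin m → Fin (suc n))
      (ec? : ∀ (h : Vec (Fin m) (suc n)) → Dec (EventuallyConstant (l ∘ lookup h))) →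
      ∀ a → sumᵛ n (λ h → weightᵛ x h * indicator (ec? (insertAt h (l a) a))) ≈
            rootedWeight n l (l a)
    rooted-sum zero l ec? a = ≈-trans (*-identityˡ _)
      (indicator-yes (ec? (insertAt [] (l a) a)) (1 , s≤s z≤n , zero , λ v → unique _))
      where
      unique : (i : Fin 1) → i ≡ zero
      unique zero = refl
    rooted-sum (suc n) l ec? a = begin
      sumᵛ (suc n) (λ h → weightᵛ x h * indicator (ec? (insertAt h (l a) a)))
        ≈⟨ sumᵛ-cong (suc n) (λ h → *-congˡ {weightᵛ x h}
             (indicator-⇔ (ec? (insertAt h (l a) a)) (forest? h) (equivalent h))) ⟩
      sumᵛ (suc n) (λ h → weightᵛ x h * indicator (forest? h))
        ≈⟨ forest-sum x n (label (l a) ∘ l) forest? ⟩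
      rootWeight x (label (l a) ∘ l) * sum x ^ n
        ≈⟨ *-congʳ (sum-cong-≋ (λ b → *-congˡ (atRoot-label (l a) (l b)))) ⟩
      rootedWeight (suc n) l (l a) ∎
      where
      equivalent : ∀ h → EventuallyConstant (l ∘ lookup (insertAt h (l a) a)) ⇔
                         IsForest (label (l a) ∘ l ∘ lookup h)
      equivalent h = mk⇔
        (λ ec v → Drains-resp same (Equivalence.to eq ec v))
        (λ F → Equivalence.from eq (λ v → Drains-resp (≡.sym ∘ same) (F v)))
        where
        eq = eventuallyConstant⇔isForest (l ∘ lookup (insertAt h (l a) a))
               (cong l (insertAt-lookup h (l a) a))
        same : label (l a) ∘ l ∘ lookup (insertAt h (l a) a) ∘ punchIn (l a) ≗
               label (l a) ∘ l ∘ lookup h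
        same v = cong (label (l a) ∘ l) (insertAt-punchIn h (l a) a v)
      forest? : ∀ h → Dec (IsForest (label (l a) ∘ l ∘ lookup h))
      forest? h = map′ (Equivalence.to (equivalent h)) (Equivalence.from (equivalent h))
        (ec? (insertAt h (l a) a))

    -- The maps are sorted by their fixed point `r` and the value `a` there, which satisfies
    -- `l a ≡ r`. Carrying out the sum over `r` leaves `a` free.
    eventuallyConstant-sum : ∀ n (l : Fin m → Fin (suc n))
      (ec? : ∀ (h : Vec (Fin m) (suc n)) → Dec (EventuallyConstant (l ∘ lookup h))) →
      sumᵛ (suc n) (λ h → weightᵛ x h * indicator (ec? h)) ≈
      ∑[ a < m ] (x a * rootedWeight n l (l a))
    eventuallyConstant-sum n l ec? = begin
      sumᵛ (suc n) (λ h → weightᵛ x h * indicator (ec? h))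
        ≈⟨ sumᵛ-cong (suc n) (λ h → ≈-trans
             (*-congˡ {weightᵛ x h} (≈-sym (fixedPoint-sum (l ∘ lookup h) (ec? h))))
             (*-distribˡ-sum (weightᵛ x h) (λ r → indicator (l (lookup h r) Fin.≟ r) * indicator (ec? h)))) ⟩
      sumᵛ (suc n) (λ h → ∑[ r < suc n ] ψ h r)
        ≈⟨ sumᵛ-∑-comm (suc n) ψ ⟩
      ∑[ r < suc n ] sumᵛ (suc n) (λ h → ψ h r)
        ≈⟨ sum-cong-≋ (λ r → sumᵛ-insertAt n (λ h → ψ h r) r) ⟩
      ∑[ r < suc n ] ∑[ a < m ] sumᵛ n (λ h → ψ (insertAt h r a) r)
        ≈⟨ sum-cong-≋ (λ r → sum-cong-≋ (λ a → value a r)) ⟩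
      ∑[ r < suc n ] ∑[ a < m ] (indicator (l a Fin.≟ r) * (x a * rootedWeight n l r))
        ≈⟨ ∑-comm (λ r a → indicator (l a Fin.≟ r) * (x a * rootedWeight n l r)) ⟩
      ∑[ a < m ] ∑[ r < suc n ] (indicator (l a Fin.≟ r) * (x a * rootedWeight n l r))
        ≈⟨ sum-cong-≋ (λ a → sum-indicator (l a) (λ r → x a * rootedWeight n l r)) ⟩
      ∑[ a < m ] (x a * rootedWeight n l (l a)) ∎
      where
      ψ : Vec (Fin m) (suc n) → Fin (suc n) → A
      ψ h r = weightᵛ x h * (indicator (l (lookup h r) Fin.≟ r) * indicator (ec? h))
      value : ∀ a r → sumᵛ n (λ h → ψ (insertAt h r a) r) ≈
                      indicator (l a Fin.≟ r) * (x a * rootedWeight n l r)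
      value a r = ≈-trans
        (sumᵛ-cong n (λ h → ≈-trans
          (*-cong (weightᵛ-insertAt x h r a) (*-congʳ (reflexive
            (cong (λ z → indicator (l z Fin.≟ r)) (insertAt-lookup h r a)))))
          (solve 4 (λ p w i c → (p ⊕ w) ⊕ (i ⊕ c) ⊜ (i ⊕ p) ⊕ (w ⊕ c)) ≈-refl
            (x a) (weightᵛ x h) (indicator (l a Fin.≟ r)) (indicator (ec? (insertAt h r a))))))
        (≈-trans (≈-sym (sumᵛ-*ˡ n (indicator (l a Fin.≟ r) * x a)
            (λ h → weightᵛ x h * indicator (ec? (insertAt h r a)))))
          (≈-trans (*-assoc _ _ _) (at-root (l a Fin.≟ r))))
        where
        open *-Solver
        -- Matching on the decision puts `l a` in place of `r`, where `rooted-sum` applies; if they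
        -- differ, both sides vanish.
        at-root : (d : Dec (l a ≡ r)) →
          indicator d * (x a * sumᵛ n (λ h → weightᵛ x h * indicator (ec? (insertAt h r a)))) ≈
          indicator d * (x a * rootedWeight n l r)
        at-root (no _)     = ≈-trans (zeroˡ _) (≈-sym (zeroˡ _))
        at-root (yes refl) = *-congˡ (*-congˡ (rooted-sum n l ec? a))

    apart-complement : ∀ {n} (l : Fin m → Fin n) →
      ∑[ a < m ] (x a * ∑[ b < m ] (x b * indicator (l a Fin.≟ l b))) +
      ∑[ a < m ] ∑[ b < m ] (x a * x b * apart (l a) (l b)) ≈ sum x * sum x
    apart-complement l = begin
      ∑[ a < m ] (x a * ∑[ b < m ] (x b * same a b)) + ∑[ a < m ] ∑[ b < m ] (x a * x b * diff a b)
        ≈⟨ +-congˡ (sum-cong-≋ (λ a → ≈-trans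
             (sum-cong-≋ (λ b → *-assoc (x a) (x b) (diff a b)))
             (≈-sym (*-distribˡ-sum (x a) (λ b → x b * diff a b))))) ⟩
      ∑[ a < m ] (x a * ∑[ b < m ] (x b * same a b)) + ∑[ a < m ] (x a * ∑[ b < m ] (x b * diff a b))
        ≈⟨ ∑-distrib-+ (λ a → x a * ∑[ b < m ] (x b * same a b)) (λ a → x a * ∑[ b < m ] (x b * diff a b)) ⟨
      ∑[ a < m ] (x a * ∑[ b < m ] (x b * same a b) + x a * ∑[ b < m ] (x b * diff a b))
        ≈⟨ sum-cong-≋ (λ a → ≈-trans
             (≈-sym (distribˡ (x a) (∑[ b < m ] (x b * same a b)) (∑[ b < m ] (x b * diff a b))))
             (*-congˡ (≈-trans (≈-sym (∑-distrib-+ (λ b → x b * same a b) (λ b → x b * diff a b)))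
               (sum-cong-≋ (λ b → ≈-trans (≈-sym (distribˡ (x b) (same a b) (diff a b)))
                 (≈-trans (*-congˡ (indicator-¬ (l a Fin.≟ l b))) (*-identityʳ (x b)))))))) ⟩
      ∑[ a < m ] (x a * sum x)
        ≈⟨ *-distribʳ-sum (sum x) x ⟨
      sum x * sum x ∎
      where
      same diff : Fin m → Fin m → A
      same a b = indicator (l a Fin.≟ l b)
      diff a b = apart (l a) (l b)

    -- The root supplies one value `a` and Cayley's formula a second value `b` with `l b ≡ l a`. The
    -- eventually constant maps thus account for the pairs with equal images, and the pairs with
    -- distinct images make up the rest of the square of the total weight.
    eventuallyConstant-complement : ∀ n .{{_ : NonZero n}} (l : Fin m → Fin n)
      (ec? : ∀ (h : Vec (Fin m) n) → Dec (EventuallyConstant (l ∘ lookup h))) →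
      sumᵛ n (λ h → weightᵛ x h * indicator (ec? h)) +
      sum x ^ (n ∸ 2) * ∑[ a < m ] ∑[ b < m ] (x a * x b * apart (l a) (l b)) ≈
      sum x ^ n
    -- The truncated exponent `1 ∸ 2` does no harm: all points of `Fin 1` are equal, so the sum `D`
    -- is zero.
    eventuallyConstant-complement (suc zero) l ec? = begin
      sumᵛ 1 (λ h → weightᵛ x h * indicator (ec? h)) + 1# * D
        ≈⟨ +-cong (eventuallyConstant-sum zero l ec?)
             (≈-trans (*-identityˡ D) (sum-zero (λ a → sum-zero (λ b → ≈-trans
               (*-congˡ (indicator-no (¬? (l a Fin.≟ l b)) (λ ≢ → ≢ (unique (l a) (l b)))))
               (zeroʳ _))))) ⟩
      ∑[ a < m ] (x a * 1#) + 0#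
        ≈⟨ +-identityʳ _ ⟩
      ∑[ a < m ] (x a * 1#)
        ≈⟨ *-distribʳ-sum 1# x ⟨
      sum x ^ 1 ∎
      where
      D = ∑[ a < m ] ∑[ b < m ] (x a * x b * apart (l a) (l b))
      unique : (i j : Fin 1) → i ≡ j
      unique zero zero = refl
    eventuallyConstant-complement (suc (suc n)) l ec? = begin
      sumᵛ (2 ℕ.+ n) (λ h → weightᵛ x h * indicator (ec? h)) + p * D
        ≈⟨ +-cong (eventuallyConstant-sum (suc n) l ec?) (*-comm p D) ⟩
      ∑[ a < m ] (x a * (S a * p)) + D * p
        ≈⟨ +-congʳ (sum-cong-≋ (λ a → *-assoc (x a) (S a) p)) ⟨
      ∑[ a < m ] (x a * S a * p) + D * p
        ≈⟨ +-congʳ (*-distribʳ-sum p (λ a → x a * S a)) ⟨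
      ∑[ a < m ] (x a * S a) * p + D * p
        ≈⟨ distribʳ p (∑[ a < m ] (x a * S a)) D ⟨
      (∑[ a < m ] (x a * S a) + D) * p
        ≈⟨ *-congʳ (apart-complement l) ⟩
      sum x * sum x * p
        ≈⟨ *-assoc (sum x) (sum x) p ⟩
      sum x ^ (2 ℕ.+ n) ∎
      where
      p = sum x ^ n
      S : Fin m → A
      S a = ∑[ b < m ] (x b * indicator (l a Fin.≟ l b))
      D = ∑[ a < m ] ∑[ b < m ] (x a * x b * apart (l a) (l b))

-- Cyclic tuples of maps

prepend : ∀ {k b} {B : Fin (suc k) → Set b} → B zero → (∀ i → B (suc i)) → ∀ i → B i
prepend b f zero    = b
prepend b f (suc i) = f i

Maps : ∀ {k} → (Fin k → ℕ) → (Fin k → ℕ) → Set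
Maps p q = ∀ i → Vec (Fin (q i)) (p i)

module _ {k : ℕ} (next : Fin k → Fin k) where

  -- The indices w, next w, next (next w), … before z are s 0, …, s (m - 1).
  Chain : ∀ m → (Fin m → Fin k) → Fin k → Fin k → Set
  Chain zero    s w z = w ≡ z
  Chain (suc m) s w z = w ≡ s zero × Chain m (s ∘ suc) (next (s zero)) z

  module _ (n : Fin k → ℕ) where

    -- Matching on the chain identifies the target of each map with the source of the next, so that
    -- no transport is left in the composite.
    run : ∀ m (s : Fin m → Fin k) {w z} → Chain m s w z →
          Maps (n ∘ s) (n ∘ next ∘ s) → Fin (n w) → Fin (n z)
    run zero    s refl       f a = a
    run (suc m) s (refl , c) f a = run m (s ∘ suc) c (f ∘ suc) (lookup (f zero) a)

module _ (k : ℕ) where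
  open Cyclic (suc k)

  -- Below the modulus `mod` changes nothing; only at the end, where `t` equals the modulus, does
  -- the index wrap round to `zero`.
  chain-mod : ∀ m t (s : Fin m → Fin (suc k)) → (∀ i → toℕ (s i) ≡ t ℕ.+ toℕ i) →
              t ℕ.+ m ≡ suc k → Chain next m s (t mod suc k) zero
  chain-mod zero    t s s≡ end = Fin.toℕ-injective (begin
    toℕ (t mod suc k)  ≡⟨ toℕ-mod t ⟩
    t % suc k          ≡⟨ cong (_% suc k) (≡.trans (≡.sym (ℕ.+-identityʳ t)) end) ⟩
    suc k % suc k      ≡⟨ n%n≡0 (suc k) ⟩
    0                  ∎)
    where open ≡-Reasoning
  chain-mod (suc m) t s s≡ end =
    Fin.toℕ-injective (begin
      toℕ (t mod suc k)  ≡⟨ toℕ-mod t ⟩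
      t % suc k          ≡⟨ m<n⇒m%n≡m t<k ⟩
      t                  ≡⟨ s₀ ⟨
      toℕ (s zero)       ∎) ,
    subst (λ u → Chain next m (s ∘ suc) (suc u mod suc k) zero) (≡.sym s₀)
      (chain-mod m (suc t) (s ∘ suc) (λ i → ≡.trans (s≡ (suc i)) (ℕ.+-suc t (toℕ i)))
        (≡.trans (≡.sym (ℕ.+-suc t m)) end))
    where
    open ≡-Reasoning
    s₀ : toℕ (s zero) ≡ t
    s₀ = ≡.trans (s≡ zero) (ℕ.+-identityʳ t)
    t<k : t ℕ.< suc k
    t<k = subst (t ℕ.<_) end (ℕ.m<m+n t ℕ.z<s)

  -- The indices after `zero` lead back to it; for a tuple of one map the chain is empty.
  cycle : Chain next k suc (next zero) zero
  cycle = chain-mod k 1 suc (λ i → refl) refl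

  round : (n : Fin (suc k) → ℕ) → Maps n (n ∘ next) → Fin (n zero) → Fin (n zero)
  round n f = run next n k suc cycle (f ∘ suc) ∘ lookup (f zero)

-- Summation over tuples of maps

module TupleSum {r ℓ} (R : CommutativeRing r ℓ) where
  open CommutativeRing R
    renaming (Carrier to A; refl to ≈-refl; sym to ≈-sym; trans to ≈-trans)
    hiding (zero)
  open Enumeration R
  open EndofunctionSum R
  open Relation.Binary.Reasoning.Setoid setoid

  sumᵗ : ∀ {k} (p q : Fin k → ℕ) → (Maps p q → A) → A
  sumᵗ {zero}  p q φ = φ (λ ())
  sumᵗ {suc k} p q φ = sumᵛ (p zero) (λ h → sumᵗ (p ∘ suc) (q ∘ suc) (λ t → φ (prepend h t)))

  sumᵗ-cong : ∀ {k} (p q : Fin k → ℕ) {φ ψ : Maps p q → A} →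
              (∀ f → φ f ≈ ψ f) → sumᵗ p q φ ≈ sumᵗ p q ψ
  sumᵗ-cong {zero}  p q e = e (λ ())
  sumᵗ-cong {suc k} p q e =
    sumᵛ-cong (p zero) (λ h → sumᵗ-cong (p ∘ suc) (q ∘ suc) (λ t → e (prepend h t)))

  sumᵗ-*ˡ : ∀ {k} (p q : Fin k → ℕ) c (φ : Maps p q → A) →
            c * sumᵗ p q φ ≈ sumᵗ p q (λ f → c * φ f)
  sumᵗ-*ˡ {zero}  p q c φ = ≈-refl
  sumᵗ-*ˡ {suc k} p q c φ = ≈-trans
    (sumᵛ-*ˡ (p zero) c (λ h → sumᵗ (p ∘ suc) (q ∘ suc) (λ t → φ (prepend h t))))
    (sumᵛ-cong (p zero) (λ h → sumᵗ-*ˡ (p ∘ suc) (q ∘ suc) c (λ t → φ (prepend h t))))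

  sumᵗ-∑-comm : ∀ {k} (p q : Fin k → ℕ) {l} (φ : Maps p q → Fin l → A) →
    sumᵗ p q (λ f → ∑[ i < l ] φ f i) ≈ ∑[ i < l ] sumᵗ p q (λ f → φ f i)
  sumᵗ-∑-comm {zero}  p q φ = ≈-refl
  sumᵗ-∑-comm {suc k} p q φ = ≈-trans
    (sumᵛ-cong (p zero) (λ h → sumᵗ-∑-comm (p ∘ suc) (q ∘ suc) (λ t → φ (prepend h t))))
    (sumᵛ-∑-comm (p zero) (λ h i → sumᵗ (p ∘ suc) (q ∘ suc) (λ t → φ (prepend h t) i)))

  sumᵗ-sumᵛ-comm : ∀ {k} (p q : Fin k → ℕ) n {m} (φ : Maps p q → Vec (Fin m) n → A) →
    sumᵗ p q (λ f → sumᵛ n (φ f)) ≈ sumᵛ n (λ h → sumᵗ p q (λ f → φ f h))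
  sumᵗ-sumᵛ-comm p q zero    φ = ≈-refl
  sumᵗ-sumᵛ-comm p q (suc n) φ = ≈-trans
    (sumᵗ-∑-comm p q (λ f u → sumᵛ n (λ h → φ f (u ∷ h))))
    (sum-cong-≋ (λ u → sumᵗ-sumᵛ-comm p q n (λ f h → φ f (u ∷ h))))

  -- Additivity is obtained as an exchange with a sum over `Fin 2`.
  sumᵗ-+ : ∀ {k} (p q : Fin k → ℕ) (φ ψ : Maps p q → A) →
           sumᵗ p q (λ f → φ f + ψ f) ≈ sumᵗ p q φ + sumᵗ p q ψ
  sumᵗ-+ p q φ ψ = begin
    sumᵗ p q (λ f → φ f + ψ f)
      ≈⟨ sumᵗ-cong p q (λ f → +-congˡ (+-identityʳ (ψ f))) ⟨
    sumᵗ p q (λ f → ∑[ i < 2 ] two f i)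
      ≈⟨ sumᵗ-∑-comm p q two ⟩
    sumᵗ p q φ + (sumᵗ p q ψ + 0#)
      ≈⟨ +-congˡ (+-identityʳ _) ⟩
    sumᵗ p q φ + sumᵗ p q ψ ∎
    where
    two : Maps p q → Fin 2 → A
    two f zero       = φ f
    two f (suc zero) = ψ f

  weightᵗ : ∀ {k} {p q : Fin k → ℕ} → (∀ i → Fin (q i) → A) → Maps p q → A
  weightᵗ x f = ∏ (λ i → weightᵛ (x i) (f i))

  sumᵗ-weightᵗ : ∀ {k} (p q : Fin k → ℕ) (x : ∀ i → Fin (q i) → A) →
                 sumᵗ p q (weightᵗ x) ≈ ∏ (λ i → sum (x i) ^ p i)
  sumᵗ-weightᵗ {zero}  p q x = ≈-refl
  sumᵗ-weightᵗ {suc k} p q x = begin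
    sumᵛ (p zero) (λ h → sumᵗ (p ∘ suc) (q ∘ suc) (λ t → weightᵛ (x zero) h * W t))
      ≈⟨ sumᵛ-cong (p zero) (λ h → sumᵗ-*ˡ (p ∘ suc) (q ∘ suc) (weightᵛ (x zero) h) W) ⟨
    sumᵛ (p zero) (λ h → weightᵛ (x zero) h * sumᵗ (p ∘ suc) (q ∘ suc) W)
      ≈⟨ sumᵛ-*ʳ (p zero) (sumᵗ (p ∘ suc) (q ∘ suc) W) (weightᵛ (x zero)) ⟨
    sumᵛ (p zero) (weightᵛ (x zero)) * sumᵗ (p ∘ suc) (q ∘ suc) W
      ≈⟨ *-cong (sumᵛ-weightᵛ (p zero) (x zero)) (sumᵗ-weightᵗ (p ∘ suc) (q ∘ suc) (x ∘ suc)) ⟩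
    ∏ (λ i → sum (x i) ^ p i) ∎
    where
    W : Maps (p ∘ suc) (q ∘ suc) → A
    W = weightᵗ (x ∘ suc)

  -- In terms of power sums this is p² - q, twice the second elementary symmetric polynomial.
  distinct : ∀ {m} → (Fin m → A) → A
  distinct {m} x = ∑[ a < m ] ∑[ b < m ] (x a * x b * apart a b)

  module _ {k : ℕ} (next : Fin k → Fin k) (n : Fin k → ℕ) (x : ∀ i → Fin (n i) → A) where

    factor : Fin k → A
    factor i = sum (x (next i)) ^ (n i ∸ 2) * distinct (x (next i))

    -- As long as the images of two points are distinct, their next images are independent,
    -- so the pairs of distinct points in the successive sets contribute separate factors.
    chain-sum : ∀ m (s : Fin m → Fin k) {w z} (c : Chain next m s w z) →
      ∑[ a < n w ] ∑[ b < n w ] (x w a * x w b *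
        sumᵗ (n ∘ s) (n ∘ next ∘ s)
          (λ f → weightᵗ (x ∘ next ∘ s) f * apart (run next n m s c f a) (run next n m s c f b)))
      ≈ distinct (x w) * ∏ (factor ∘ s)
    chain-sum zero s {w} refl = ≈-trans
      (sum-cong-≋ (λ a → sum-cong-≋ (λ b → *-congˡ {x w a * x w b} (*-identityˡ (apart a b)))))
      (≈-sym (*-identityʳ (distinct (x w))))
    chain-sum (suc m) s (refl , c) = begin
      ∑[ a < n w ] ∑[ b < n w ] (x w a * x w b * pairSum a b)
        ≈⟨ sum-cong-≋ (λ a → sum-cong-≋ (λ b → ≈-trans
             (*-congˡ {x w a * x w b} (pair-value a b))
             (≈-sym (*-assoc (x w a * x w b) (apart a b) K)))) ⟩
      ∑[ a < n w ] ∑[ b < n w ] (x w a * x w b * apart a b * K)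
        ≈⟨ sum-cong-≋ (λ a → *-distribʳ-sum K (λ b → x w a * x w b * apart a b)) ⟨
      ∑[ a < n w ] (∑[ b < n w ] (x w a * x w b * apart a b) * K)
        ≈⟨ *-distribʳ-sum K (λ a → ∑[ b < n w ] (x w a * x w b * apart a b)) ⟨
      distinct (x w) * K ∎
      where
      w = s zero
      p = n ∘ s ∘ suc
      q = n ∘ next ∘ s ∘ suc
      K = ∏ (factor ∘ s)
      xʷ = x (next w)
      W : Maps p q → A
      W = weightᵗ (x ∘ next ∘ s ∘ suc)
      images : Maps p q → Fin (n (next w)) → Fin (n (next w)) → A
      images t a b = apart (run next n m (s ∘ suc) c t a) (run next n m (s ∘ suc) c t b)
      later : Fin (n (next w)) → Fin (n (next w)) → A
      later a b = sumᵗ p q (λ t → W t * images t a b)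
      pairSum : Fin (n w) → Fin (n w) → A
      pairSum a b = sumᵛ (n w) (λ h → sumᵗ p q (λ t →
        weightᵛ xʷ h * W t * images t (lookup h a) (lookup h b)))
      pairSum′ : ∀ a b → pairSum a b ≈
        sumᵛ (n w) (λ h → weightᵛ xʷ h * later (lookup h a) (lookup h b))
      pairSum′ a b = sumᵛ-cong (n w) (λ h → ≈-trans
        (sumᵗ-cong p q (λ t → *-assoc (weightᵛ xʷ h) (W t) (images t (lookup h a) (lookup h b))))
        (≈-sym (sumᵗ-*ˡ p q (weightᵛ xʷ h) (λ t → W t * images t (lookup h a) (lookup h b)))))
      -- Two points that have merged are never separated again, so they contribute nothing.
      later-refl : ∀ a → later a a ≈ 0#
      later-refl a = ≈-trans
        (sumᵗ-cong p q (λ t → ≈-trans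
          (*-congˡ {W t} (indicator-no (¬? (run next n m (s ∘ suc) c t a Fin.≟ _)) (λ ≢ → ≢ refl)))
          (≈-trans (zeroʳ (W t)) (≈-sym (zeroˡ 0#)))))
        (≈-trans (≈-sym (sumᵗ-*ˡ p q 0# (λ _ → 0#))) (zeroˡ _))
      -- The contribution `K` is the same for every pair of distinct points and therefore comes out
      -- of the sum over pairs.
      pair-value : ∀ a b → pairSum a b ≈ apart a b * K
      pair-value a b with a Fin.≟ b
      ... | yes refl = ≈-trans (pairSum′ a a) (≈-trans
        (sumᵛ-zero (n w) (λ h → ≈-trans (*-congˡ {weightᵛ xʷ h} (later-refl (lookup h a)))
          (zeroʳ (weightᵛ xʷ h))))
        (≈-sym (zeroˡ K)))
      ... | no a≢b = begin
        pairSum a b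
          ≈⟨ pairSum′ a b ⟩
        sumᵛ (n w) (λ h → weightᵛ xʷ h * later (lookup h a) (lookup h b))
          ≈⟨ sumᵛ-two-points (n w) xʷ a b a≢b later ⟩
        sum xʷ ^ (n w ∸ 2) * ∑[ a < n (next w) ] ∑[ b < n (next w) ] (xʷ a * xʷ b * later a b)
          ≈⟨ *-congˡ (chain-sum m (s ∘ suc) c) ⟩
        sum xʷ ^ (n w ∸ 2) * (distinct xʷ * ∏ (factor ∘ s ∘ suc))
          ≈⟨ *-assoc _ _ _ ⟨
        K
          ≈⟨ *-identityˡ K ⟨
        1# * K ∎

  module _ (k : ℕ) (n : Fin (suc k) → ℕ) (x : ∀ i → Fin (n i) → A) where
    open Cyclic (suc k)

    eventuallyConstantTuple-sum : .{{_ : NonZero (n zero)}} →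
      (ec? : ∀ f → Dec (EventuallyConstant (round k n f))) →
      sumᵗ n (n ∘ next) (λ f → weightᵗ (x ∘ next) f * indicator (ec? f)) + ∏ (factor next n x) ≈
      ∏ (λ i → sum (x (next i)) ^ n i)
    eventuallyConstantTuple-sum ec? = begin
      sumᵛ (n zero) (λ h → sumᵗ p q (λ t → weightᵛ x₁ h * W t * indicator (ec? (prepend h t))))
        + ∏ (factor next n x)
        ≈⟨ +-cong
             -- The first map is summed innermost: for fixed later maps `t` the endofunction is
             -- `l t` after an arbitrary map.
             (≈-trans (≈-sym (sumᵗ-sumᵛ-comm p q (n zero) _))
               (sumᵗ-cong p q (λ t → ≈-trans
                 (sumᵛ-cong (n zero) (λ h → ≈-trans
                   (*-assoc (weightᵛ x₁ h) (W t) (indicator (ec? (prepend h t))))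
                   (x*yz≈y*xz (weightᵛ x₁ h) (W t) (indicator (ec? (prepend h t))))))
                 (≈-sym (sumᵛ-*ˡ (n zero) (W t) (λ h → weightᵛ x₁ h * indicator (ec? (prepend h t))))))))
             (≈-sym nonconstant) ⟩
      sumᵗ p q (λ t → W t * E t) + sumᵗ p q (λ t → W t * (u * D t))
        ≈⟨ sumᵗ-+ p q (λ t → W t * E t) (λ t → W t * (u * D t)) ⟨
      sumᵗ p q (λ t → W t * E t + W t * (u * D t))
        ≈⟨ sumᵗ-cong p q (λ t → ≈-trans (≈-sym (distribˡ (W t) (E t) (u * D t)))
             (≈-trans (*-congˡ {W t} (eventuallyConstant-complement x₁ (n zero) (l t) (λ h → ec? (prepend h t))))
               (*-comm (W t) (sum x₁ ^ n zero)))) ⟩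
      sumᵗ p q (λ t → sum x₁ ^ n zero * W t)
        ≈⟨ sumᵗ-*ˡ p q (sum x₁ ^ n zero) W ⟨
      sum x₁ ^ n zero * sumᵗ p q W
        ≈⟨ *-congˡ (sumᵗ-weightᵗ p q (x ∘ next ∘ suc)) ⟩
      ∏ (λ i → sum (x (next i)) ^ n i) ∎
      where
      p = n ∘ suc
      q = n ∘ next ∘ suc
      w = next zero
      x₁ = x w
      u = sum x₁ ^ (n zero ∸ 2)
      W : Maps p q → A
      W = weightᵗ (x ∘ next ∘ suc)
      l : Maps p q → Fin (n w) → Fin (n zero)
      l = run next n k suc (cycle k)
      E D : Maps p q → A
      E t = sumᵛ (n zero) (λ h → weightᵛ x₁ h * indicator (ec? (prepend h t)))
      D t = ∑[ a < n w ] ∑[ b < n w ] (x₁ a * x₁ b * apart (l t a) (l t b))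
      term : Maps p q → Fin (n w) → Fin (n w) → A
      term t a b = x₁ a * x₁ b * apart (l t a) (l t b)
      -- The two points, which lie in the second set, are moved outside the sum over the later maps;
      -- this is the shape to which `chain-sum` applies.
      nonconstant : sumᵗ p q (λ t → W t * (u * D t)) ≈ ∏ (factor next n x)
      nonconstant = begin
        sumᵗ p q (λ t → W t * (u * D t))
          ≈⟨ sumᵗ-cong p q (λ t → x*yz≈y*xz (W t) u (D t)) ⟩
        sumᵗ p q (λ t → u * (W t * D t))
          ≈⟨ sumᵗ-*ˡ p q u (λ t → W t * D t) ⟨
        u * sumᵗ p q (λ t → W t * D t)
          ≈⟨ *-congˡ (sumᵗ-cong p q (λ t → ≈-trans
               (*-distribˡ-sum (W t) (λ a → ∑[ b < n w ] term t a b))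
               (sum-cong-≋ (λ a → *-distribˡ-sum (W t) (term t a))))) ⟩
        u * sumᵗ p q (λ t → ∑[ a < n w ] ∑[ b < n w ] (W t * term t a b))
          ≈⟨ *-congˡ (≈-trans
               (sumᵗ-∑-comm p q (λ t a → ∑[ b < n w ] (W t * term t a b)))
               (sum-cong-≋ (λ a → sumᵗ-∑-comm p q (λ t b → W t * term t a b)))) ⟩
        u * ∑[ a < n w ] ∑[ b < n w ] sumᵗ p q (λ t → W t * term t a b)
          ≈⟨ *-congˡ (sum-cong-≋ (λ a → sum-cong-≋ (λ b → ≈-trans
               (sumᵗ-cong p q (λ t → x*yz≈y*xz (W t) (x₁ a * x₁ b) (apart (l t a) (l t b))))
               (≈-sym (sumᵗ-*ˡ p q (x₁ a * x₁ b) (λ t → W t * apart (l t a) (l t b))))))) ⟩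
        u * ∑[ a < n w ] ∑[ b < n w ] (x₁ a * x₁ b *
          sumᵗ p q (λ t → W t * apart (l t a) (l t b)))
          ≈⟨ *-congˡ (chain-sum next n x k suc (cycle k)) ⟩
        u * (distinct x₁ * ∏ (factor next n x ∘ suc))
          ≈⟨ *-assoc u (distinct x₁) (∏ (factor next n x ∘ suc)) ⟨
        ∏ (factor next n x) ∎

-- The generating polynomial

module ListSum {r ℓ} (R : CommutativeRing r ℓ) where
  open CommutativeRing R
    renaming (Carrier to A; refl to ≈-refl; sym to ≈-sym; trans to ≈-trans)
    hiding (zero)
  open Enumeration R
  open TupleSum R

  sumˡ : ∀ {b} {B : Set b} → List B → (B → A) → A
  sumˡ L φ = foldr _+_ 0# (map φ L)

  module _ {b} {B : Set b} where

    sumˡ-cong : (L : List B) {φ ψ : B → A} → (∀ b → φ b ≈ ψ b) → sumˡ L φ ≈ sumˡ L ψ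
    sumˡ-cong []      e = ≈-refl
    sumˡ-cong (b ∷ L) e = +-cong (e b) (sumˡ-cong L e)

    sumˡ-++ : (L L′ : List B) (φ : B → A) → sumˡ (L ++ L′) φ ≈ sumˡ L φ + sumˡ L′ φ
    sumˡ-++ []      L′ φ = ≈-sym (+-identityˡ _)
    sumˡ-++ (b ∷ L) L′ φ = ≈-trans (+-congˡ (sumˡ-++ L L′ φ)) (≈-sym (+-assoc _ _ _))

    sumˡ-filter : ∀ {p} {P : Pred B p} (P? : Decidable P) (L : List B) (φ : B → A) →
                  sumˡ (filter P? L) φ ≈ sumˡ L (λ b → φ b * indicator (P? b))
    sumˡ-filter P? []      φ = ≈-refl
    sumˡ-filter P? (b ∷ L) φ with P? b
    ... | yes _ = +-cong (≈-sym (*-identityʳ _)) (sumˡ-filter P? L φ)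
    ... | no _  = ≈-trans (sumˡ-filter P? L φ)
      (≈-sym (≈-trans (+-congʳ (zeroʳ _)) (+-identityˡ _)))

    sumˡ-tabulate : ∀ {m} (e : Fin m → B) (φ : B → A) → sumˡ (tabulate e) φ ≈ sum (φ ∘ e)
    sumˡ-tabulate {zero}  e φ = ≈-refl
    sumˡ-tabulate {suc m} e φ = +-congˡ (sumˡ-tabulate (e ∘ suc) φ)

    sumˡ-map : ∀ {c} {C : Set c} (g : C → B) (L : List C) (φ : B → A) →
               sumˡ (map g L) φ ≈ sumˡ L (φ ∘ g)
    sumˡ-map g []      φ = ≈-refl
    sumˡ-map g (c ∷ L) φ = +-congˡ (sumˡ-map g L φ)

  sumˡ-cartesianProductWith : ∀ {b c d} {B : Set b} {C : Set c} {D : Set d}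
    (g : B → C → D) (L : List B) (L′ : List C) (φ : D → A) →
    sumˡ (cartesianProductWith g L L′) φ ≈ sumˡ L (λ b → sumˡ L′ (λ c → φ (g b c)))
  sumˡ-cartesianProductWith g []      L′ φ = ≈-refl
  sumˡ-cartesianProductWith g (b ∷ L) L′ φ = ≈-trans
    (sumˡ-++ (map (g b) L′) (cartesianProductWith g L L′) φ)
    (+-cong (sumˡ-map (g b) L′ φ) (sumˡ-cartesianProductWith g L L′ φ))

  -- prepend agrees only pointwise with the local function of choices.
  sumˡ-choices : ∀ {m b} {B : Fin (suc m) → Set b} (bs : ∀ i → List (B i))
    (φ : (∀ i → B i) → A) → (∀ f g → (∀ i → f i ≡ g i) → φ f ≈ φ g) →
    sumˡ (choices bs) φ ≈ sumˡ (bs zero) (λ b → sumˡ (choices (bs ∘ suc)) (λ f → φ (prepend b f)))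
  sumˡ-choices bs φ resp = ≈-trans
    (sumˡ-cartesianProductWith _ (bs zero) (choices (bs ∘ suc)) φ)
    (sumˡ-cong (bs zero) (λ b → sumˡ-cong (choices (bs ∘ suc)) (λ f → resp _ _ (λ where
      zero    → refl
      (suc i) → refl))))

  -- The listed functions and the lookups of vectors agree only pointwise, so `φ` has to respect
  -- pointwise equality.
  sumˡ-maps : ∀ n {m b} {B : Set b} (e : Fin m → B) (φ : (Fin n → B) → A) →
    (∀ f g → f ≗ g → φ f ≈ φ g) →
    sumˡ (choices {n} (λ _ → tabulate e)) φ ≈ sumᵛ n (λ h → φ (e ∘ lookup h))
  sumˡ-maps zero    e φ resp = ≈-trans (+-identityʳ _) (resp _ _ (λ ()))
  sumˡ-maps (suc n) e φ resp = ≈-trans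
    (sumˡ-choices (λ _ → tabulate e) φ resp)
    (≈-trans (sumˡ-tabulate e (λ b → sumˡ (choices {n} (λ _ → tabulate e)) (φ ∘ prepend b)))
      (sum-cong-≋ (λ u → ≈-trans
        (sumˡ-maps n e (φ ∘ prepend (e u)) (λ f g f≗g → resp _ _ (λ where
          zero    → refl
          (suc i) → f≗g i)))
        (sumᵛ-cong n (λ h → resp _ _ (λ where
          zero    → refl
          (suc i) → refl))))))

  sumˡ-tuples : ∀ {k a b} {S : Fin k → Set a} {T : Fin k → Set b} (p q : Fin k → ℕ)
    (to : ∀ i → S i → Fin (p i)) (e : ∀ i → Fin (q i) → T i)
    (φ : (∀ i → S i → T i) → A) → (∀ f g → (∀ i → f i ≗ g i) → φ f ≈ φ g) →
    sumˡ (choices (λ i → map (_∘ to i) (choices {p i} (λ _ → tabulate (e i))))) φ ≈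
    sumᵗ p q (λ f → φ (λ i → e i ∘ lookup (f i) ∘ to i))
  sumˡ-tuples {zero}  p q to e φ resp = ≈-trans (+-identityʳ _) (resp _ _ (λ ()))
  sumˡ-tuples {suc k} p q to e φ resp = ≈-trans
    (sumˡ-choices bs φ (λ f g f≡g → resp f g (λ i v → cong (λ h → h v) (f≡g i))))
    (≈-trans (sumˡ-map (_∘ to zero) (choices {p zero} (λ _ → tabulate (e zero))) ψ)
      (≈-trans
        (sumˡ-maps (p zero) (e zero) (λ h → ψ (h ∘ to zero))
          (λ f g f≗g → sumˡ-cong (choices (bs ∘ suc)) (λ t → resp _ _ (λ where
            zero    v → f≗g (to zero v)
            (suc i) v → refl))))
        (sumᵛ-cong (p zero) (λ h → ≈-trans
          (sumˡ-tuples (p ∘ suc) (q ∘ suc) (to ∘ˢ) (e ∘ˢ)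
            (λ t → φ (prepend (e zero ∘ lookup h ∘ to zero) t))
            (λ f g f≗g → resp _ _ (λ where
              zero    v → refl
              (suc i) v → f≗g i v)))
          (sumᵗ-cong (p ∘ suc) (q ∘ suc) (λ t → resp _ _ (λ where
            zero    v → refl
            (suc i) v → refl)))))))
    where
    _∘ˢ : ∀ {c} {C : Fin (suc k) → Set c} → (∀ i → C i) → ∀ i → C (suc i)
    (f ∘ˢ) i = f (suc i)
    bs = λ i → map (_∘ to i) (choices {p i} (λ _ → tabulate (e i)))
    ψ = λ f₀ → sumˡ (choices (bs ∘ suc)) (λ t → φ (prepend f₀ t))

-- From tuples on the given sets to tuples of vectors

module _ {a b} {B : Set a} {C : Set b} (enum : B ↔ C) where
  open Inverse enum
  private
    module FromB = Endo B
    module FromC = Endo C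

  eventuallyConstant-conjugate : ∀ {f : B → B} {g : C → C} →
    (∀ v → f (from v) ≡ from (g v)) → EventuallyConstant f ⇔ EventuallyConstant g
  eventuallyConstant-conjugate {f} {g} f∘from = mk⇔
    (λ (m , 1≤m , c , p) → m , 1≤m , to c , λ v → begin
      (g FromC.^ m) v                ≡⟨ strictlyInverseˡ _ ⟨
      to (from ((g FromC.^ m) v))    ≡⟨ cong to (power m v) ⟨
      to ((f FromB.^ m) (from v))    ≡⟨ cong to (p (from v)) ⟩
      to c                           ∎)
    (λ (m , 1≤m , c , p) → m , 1≤m , from c , λ v → begin
      (f FromB.^ m) v                ≡⟨ cong (f FromB.^ m) (strictlyInverseʳ v) ⟨
      (f FromB.^ m) (from (to v))    ≡⟨ power m (to v) ⟩
      from ((g FromC.^ m) (to v))    ≡⟨ cong from (p (to v)) ⟩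
      from c                         ∎)
    where
    open ≡-Reasoning
    power : ∀ m v → (f FromB.^ m) (from v) ≡ from ((g FromC.^ m) v)
    power zero    v = refl
    power (suc m) v = ≡.trans (cong f (power m v)) (f∘from _)

eventuallyConstant-resp : ∀ {a} {B : Set a} {f g : B → B} → f ≗ g →
                          EventuallyConstant f → EventuallyConstant g
eventuallyConstant-resp {B = B} {f} {g} f≗g (m , 1≤m , c , p) =
  m , 1≤m , c , λ v → ≡.trans (≡.sym (power m v)) (p v)
  where
  open Endo B using (_^_)
  power : ∀ m → f ^ m ≗ g ^ m
  power zero    v = refl
  power (suc m) v = ≡.trans (f≗g _) (cong g (power m v))

module _ {k : ℕ} .{{_ : NonZero k}} {a} (X : Fin k → Set a) where
  open Cyclic k
  open Endo (Σ (Fin k) X) using (_^_)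

  -- On the disjoint union a path through the various sets becomes an orbit of a single
  -- endofunction, which postpones all transport between the sets.
  move : Tuple X → Σ (Fin k) X → Σ (Fin k) X
  move f (i , v) = next i , f i v

  path-move : ∀ f m {i} (v : X i) → (next^ m i , path X f m v) ≡ (move f ^ m) (i , v)
  path-move f zero    v = refl
  path-move f (suc m) v = cong (move f) (path-move f m v)

  path-resp : ∀ {f g : Tuple X} → (∀ i → f i ≗ g i) → ∀ m {i} (v : X i) →
              path X f m v ≡ path X g m v
  path-resp             f≗g zero    v = refl
  path-resp {f} {g} f≗g (suc m) v = ≡.trans (f≗g _ _) (cong (g _) (path-resp f≗g m v))

  composite-resp : ∀ {f g : Tuple X} → (∀ i → f i ≗ g i) → composite X f ≗ composite X g
  composite-resp f≗g v = cong (subst X (next^-k first)) (path-resp f≗g k v)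

  -- Identity proofs are unique, so the transport is determined by the pairs and not by the proof of
  -- `i ≡ j`.
  subst-pair : ∀ {i j u v} (e : i ≡ j) → (i , u) ≡ (j , v) → subst X e u ≡ v
  subst-pair refl refl = refl

module _ {k : ℕ} .{{_ : NonZero k}} {a} (X : Fin k → Set a) (n : Fin k → ℕ)
         (enum : ∀ i → X i ↔ Fin (n i)) where
  open Cyclic k
  open Tuples k X n enum using (element)
  open Endo (Σ (Fin k) X) using (_^_)

  onElements : Maps n (n ∘ next) → Tuple X
  onElements f i = element (next i) ∘ lookup (f i) ∘ Inverse.to (enum i)

  onElements-element : ∀ f i a →
    onElements f i (element i a) ≡ element (next i) (lookup (f i) a)
  onElements-element f i a =
    cong (element (next i) ∘ lookup (f i)) (Inverse.strictlyInverseˡ (enum i) a)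

  -- `run` applies the head of the chain first, so the power is unrolled at its inner end by
  -- `^-suc`.
  run-move : ∀ f m (s : Fin m → Fin k) {w z} (c : Chain next m s w z) a →
    (move X (onElements f) ^ m) (w , element w a) ≡
    (z , element z (run next n m s c (λ i → f (s i)) a))
  run-move f zero    s refl       a = refl
  run-move f (suc m) s (refl , c) a = ≡.trans
    (^-suc (move X (onElements f)) m _)
    (≡.trans (cong (λ v → (move X (onElements f) ^ m) (next (s zero) , v))
        (onElements-element f (s zero) a))
      (run-move f m (s ∘ suc) c _))

module _ (k : ℕ) {a} (X : Fin (suc k) → Set a) (n : Fin (suc k) → ℕ)
         (enum : ∀ i → X i ↔ Fin (n i)) where
  open Cyclic (suc k)
  open Tuples (suc k) X n enum using (element; EC)
  open Endo (Σ (Fin (suc k)) X) using (_^_)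

  -- The composite is a power of `move` up to the final transport; its first step uses `f zero`, and
  -- the other `k` steps follow `cycle`.
  composite-element : ∀ f a → composite X (onElements X n enum f) (element zero a) ≡
                              element zero (round k n f a)
  composite-element f a = subst-pair X (next^-k first) (begin
    (next^ (suc k) zero , path X F (suc k) (element zero a))
      ≡⟨ path-move X F (suc k) (element zero a) ⟩
    (move X F ^ suc k) (zero , element zero a)
      ≡⟨ ^-suc (move X F) k _ ⟩
    (move X F ^ k) (next zero , F zero (element zero a))
      ≡⟨ cong (λ v → (move X F ^ k) (next zero , v)) (onElements-element X n enum f zero a) ⟩
    (move X F ^ k) (next zero , element (next zero) (lookup (f zero) a))
      ≡⟨ run-move X n enum f k suc (cycle k) (lookup (f zero) a) ⟩
    (zero , element zero (round k n f a)) ∎)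
    where
    open ≡-Reasoning
    F = onElements X n enum f

  EC⇔round : ∀ f → EC (onElements X n enum f) ⇔ EventuallyConstant (round k n f)
  EC⇔round f = eventuallyConstant-conjugate (enum zero) (composite-element f)

module _ (k : ℕ) .{{nz : NonZero (suc k)}} {a} (X : Fin (suc k) → Set a) (n : Fin (suc k) → ℕ)
         (enum : ∀ i → X i ↔ Fin (n i)) {r ℓ} (R : CommutativeRing r ℓ)
         (x : ∀ i → X i → CommutativeRing.Carrier R) where
  open CommutativeRing R
    renaming (Carrier to A; refl to ≈-refl; sym to ≈-sym; trans to ≈-trans)
    hiding (zero)
  open Enumeration R
  open TupleSum R
  open ListSum R
  open Cyclic (suc k) {{nz}}
  open Tuples (suc k) {{nz}} X n enum

  private
    y : ∀ i → Fin (n i) → A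
    y i = x i ∘ element i

    F : Maps n (n ∘ next) → Tuple X
    F = onElements X n enum

  -- Filtering becomes multiplication by an indicator, the list of tuples becomes a sum over
  -- vectors, and the composite is conjugate to `round`.
  P-sum-suc : .{{_ : NonZero (n zero)}} →
          P R x + ∏ (factor next n y) ≈ ∏ (λ i → sum (y (next i)) ^ n i)
  P-sum-suc = ≈-trans
    (+-congʳ (≈-trans
      (sumˡ-filter EC? tuples (weight R x))
      (≈-trans
        (sumˡ-tuples n (n ∘ next) (λ i → Inverse.to (enum i)) (element ∘ next)
          (λ f → weight R x f * indicator (EC? f))
          (λ f g f≗g → *-cong
            (∏.sum-cong-≋ (λ i → ∏.sum-cong-≋ (λ v → reflexive (cong (x (next i)) (f≗g i (element i v))))))
            (indicator-⇔ (EC? f) (EC? g) (mk⇔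
              (eventuallyConstant-resp (composite-resp X f≗g))
              (eventuallyConstant-resp (composite-resp X (λ i v → ≡.sym (f≗g i v))))))))
        (sumᵗ-cong n (n ∘ next) (λ f → *-cong
          (∏.sum-cong-≋ (λ i → ∏.sum-cong-≋ (λ v →
            reflexive (cong (x (next i)) (onElements-element X n enum f i v)))))
          (indicator-⇔ (EC? (F f)) (ec? f) (EC⇔round k X n enum f)))))))
    (eventuallyConstantTuple-sum k n y ec?)
    where
    ec? : ∀ f → Dec (EventuallyConstant (round k n f))
    ec? f = map′ (Equivalence.to (EC⇔round k X n enum f)) (Equivalence.from (EC⇔round k X n enum f)) (EC? (F f))

-- Reindexing by the predecessor

module _ (k : ℕ) .{{_ : NonZero k}} where
  open Cyclic k

  private
    %-+ : ∀ a b → (a % k ℕ.+ b) % k ≡ (a ℕ.+ b) % k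
    %-+ a b = begin
      (a % k ℕ.+ b) % k          ≡⟨ %-distribˡ-+ (a % k) b k ⟩
      (a % k % k ℕ.+ b % k) % k  ≡⟨ cong (λ z → (z ℕ.+ b % k) % k) (m%n%n≡m%n a k) ⟩
      (a % k ℕ.+ b % k) % k      ≡⟨ %-distribˡ-+ a b k ⟨
      (a ℕ.+ b) % k              ∎
      where open ≡-Reasoning

    around : ∀ (i : Fin k) → (suc (toℕ i) ℕ.+ ℕ.pred k) % k ≡ toℕ i
    around i = begin
      (suc (toℕ i) ℕ.+ ℕ.pred k) % k  ≡⟨ cong (_% k) (ℕ.+-suc (toℕ i) (ℕ.pred k)) ⟨
      (toℕ i ℕ.+ suc (ℕ.pred k)) % k  ≡⟨ cong (λ z → (toℕ i ℕ.+ z) % k) (ℕ.suc-pred k) ⟩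
      (toℕ i ℕ.+ k) % k               ≡⟨ [m+n]%n≡m%n (toℕ i) k ⟩
      toℕ i % k                       ≡⟨ m<n⇒m%n≡m (Fin.toℕ<n i) ⟩
      toℕ i                           ∎
      where open ≡-Reasoning

  prev-next : ∀ i → prev (next i) ≡ i
  prev-next i = Fin.toℕ-injective (begin
    toℕ (prev (next i))                   ≡⟨ toℕ-mod (toℕ (next i) ℕ.+ ℕ.pred k) ⟩
    (toℕ (next i) ℕ.+ ℕ.pred k) % k       ≡⟨ cong (λ z → (z ℕ.+ ℕ.pred k) % k) (toℕ-mod (suc (toℕ i))) ⟩
    (suc (toℕ i) % k ℕ.+ ℕ.pred k) % k    ≡⟨ %-+ (suc (toℕ i)) (ℕ.pred k) ⟩
    (suc (toℕ i) ℕ.+ ℕ.pred k) % k        ≡⟨ around i ⟩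
    toℕ i                                 ∎)
    where open ≡-Reasoning

  next-prev : ∀ i → next (prev i) ≡ i
  next-prev i = Fin.toℕ-injective (begin
    toℕ (next (prev i))                   ≡⟨ toℕ-mod (suc (toℕ (prev i))) ⟩
    suc (toℕ (prev i)) % k                ≡⟨ cong (λ z → suc z % k) (toℕ-mod (toℕ i ℕ.+ ℕ.pred k)) ⟩
    suc ((toℕ i ℕ.+ ℕ.pred k) % k) % k    ≡⟨ suc-% (toℕ i ℕ.+ ℕ.pred k) ⟩
    suc (toℕ i ℕ.+ ℕ.pred k) % k          ≡⟨ around i ⟩
    toℕ i                                 ∎)
    where open ≡-Reasoning

  rotation : Permutation k k
  rotation = permutation next prev next-prev prev-next

module _ {r ℓ} (R : CommutativeRing r ℓ) where
  open CommutativeRing R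
    renaming (Carrier to A; refl to ≈-refl; sym to ≈-sym; trans to ≈-trans)
    hiding (zero)
  open Enumeration R
  open TupleSum R

  -- Since `next` permutes the indices, each factor can be indexed by the set in which the map takes
  -- its values, as in the tensor products.
  ∏-rotate : ∀ k .{{_ : NonZero k}} → let open Cyclic k in
    (f : Fin k → Fin k → A) → ∏ (λ i → f i (next i)) ≈ ∏ (λ i → f (prev i) i)
  ∏-rotate k f = ≈-trans
    (reflexive (∏.sum-cong-≗ (λ i → cong (λ j → f j (next i)) (≡.sym (prev-next k i)))))
    (≈-sym (∏.sum-permute (λ i → f (prev i) i) (rotation k)))
    where open Cyclic k

  P-sum : ∀ {a} k .{{_ : NonZero k}} (X : Fin k → Set a) (n : Fin k → ℕ) →
    (∀ i → NonZero (n i)) → (enum : ∀ i → X i ↔ Fin (n i)) (x : ∀ i → X i → A) →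
    let open Cyclic k
        open Tuples k X n enum
        y = λ i → x i ∘ element i
    in P R x + ∏ (factor next n y) ≈ ∏ (λ i → sum (y (next i)) ^ n i)
  P-sum (suc k) {{nz}} X n nonempty enum x = P-sum-suc k {{nz}} X n enum R x {{nonempty zero}}

  module _ {a} (k : ℕ) .{{_ : NonZero k}} (X : Fin k → Set a) (n : Fin k → ℕ)
           (nonempty : ∀ i → NonZero (n i)) (enum : ∀ i → X i ↔ Fin (n i)) (x : ∀ i → X i → A) where
    open Cyclic k
    open Tuples k X n enum

    private
      y : ∀ i → Fin (n i) → A
      y i = x i ∘ element i

    P-sum-prev : P R x + ∏ (λ i → sum (y i) ^ (n (prev i) ∸ 2) * distinct (y i)) ≈
                 ∏ (λ i → sum (y i) ^ n (prev i))
    P-sum-prev = ≈-trans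
      (+-congˡ {P R x} (≈-sym (∏-rotate k (λ j i → sum (y i) ^ (n j ∸ 2) * distinct (y i)))))
      (≈-trans (P-sum k X n nonempty enum x)
        (∏-rotate k (λ j i → sum (y i) ^ n j)))

-- Characters

module Characters {r ℓ} (R : CommutativeRing r ℓ) where
  open CommutativeRing R
    renaming (Carrier to A; refl to ≈-refl; sym to ≈-sym; trans to ≈-trans)
    hiding (zero)
  open Enumeration R hiding (sum-zero)
  open EndofunctionSum R
  open TupleSum R
  open Representations R
  open Representation
  open Algebra.Properties.Monoid.Mult +-monoid using () renaming (_×_ to _ℕ·_; ×-congʳ to ℕ·-congʳ; ×-assocˡ to ℕ·-assocˡ)
  open Algebra.Properties.Semiring.Mult semiring using (×-comm-*; ×-assoc-*)
  open Relation.Binary.Reasoning.Setoid setoid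

  trace-kronecker : ∀ {d e} (M : Matrix d) (N : Matrix e) →
                    trace (kronecker M N) ≈ trace M * trace N
  trace-kronecker {d} {e} M N = ≈-trans
    (sum-remQuot d e (λ (i , j) → M i i * N j j))
    (≈-sym (sum-* (λ i → M i i) (λ j → N j j)))

  trace-diagonal : ∀ {d} (t : Fin d → A) → trace (diagonal t) ≈ sum t
  trace-diagonal t = sum-cong-≋ (λ i → reflexive (diagonal-same t i))

  -- The diagonal entry at a pair a < b is `t a * t b`. Taking the trace twice counts both orders of
  -- the pair, which avoids division by 2 in the ring.
  trace-exteriorSquare : ∀ {d} (t : Fin d → A) →
    trace (exteriorSquare (diagonal t)) + trace (exteriorSquare (diagonal t)) ≈ distinct t
  trace-exteriorSquare {d} t = begin
    trace (exteriorSquare (diagonal t)) + trace (exteriorSquare (diagonal t))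
      ≈⟨ ∑-distrib-+ (λ p → exteriorSquare (diagonal t) p p) (λ p → exteriorSquare (diagonal t) p p) ⟨
    ∑[ p < pairCount d ] (exteriorSquare (diagonal t) p p + exteriorSquare (diagonal t) p p)
      ≈⟨ sum-cong-≋ (λ p → minor (pair d p) (pair-< d p)) ⟩
    ∑[ p < pairCount d ] both (pair d p)
      ≈⟨ +-identityˡ _ ⟨
    -- The zero stands for the diagonal terms, which vanish because no point is apart from itself.
    0# + ∑[ p < pairCount d ] both (pair d p)
      ≈⟨ +-congʳ (sum-zero (λ a → ≈-trans
           (*-congˡ {t a * t a} (indicator-no (¬? (a Fin.≟ a)) (λ ≢ → ≢ refl))) (zeroʳ (t a * t a)))) ⟨
    ∑[ a < d ] h a a + ∑[ p < pairCount d ] both (pair d p)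
      ≈⟨ sum-pairs h ⟨
    distinct t ∎
    where
    h : Fin d → Fin d → A
    h a b = t a * t b * apart a b
    both : Fin d × Fin d → A
    both (a , b) = h a b + h b a
    minor : ((a , b) : Fin d × Fin d) → toℕ a ℕ.< toℕ b →
      let m = diagonal t a a * diagonal t b b - diagonal t a b * diagonal t b a
      in m + m ≈ both (a , b)
    minor (a , b) a<b = +-cong
      (≈-trans value (≈-sym (≈-trans (*-congˡ (indicator-yes (¬? (a Fin.≟ b)) a≢b)) (*-identityʳ _))))
      (≈-trans value (≈-sym (≈-trans (*-congˡ (indicator-yes (¬? (b Fin.≟ a)) (a≢b ∘ ≡.sym)))
        (≈-trans (*-identityʳ _) (*-comm (t b) (t a))))))
      where
      a≢b : a ≢ b
      a≢b refl = ℕ.<-irrefl refl a<b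
      value : diagonal t a a * diagonal t b b - diagonal t a b * diagonal t b a ≈ t a * t b
      value = begin
        diagonal t a a * diagonal t b b - diagonal t a b * diagonal t b a
          ≡⟨ cong₂ _-_ (cong₂ _*_ (diagonal-same t a) (diagonal-same t b))
                       (cong (_* diagonal t b a) (diagonal-diff t a≢b)) ⟩
        t a * t b - 0# * diagonal t b a
          ≈⟨ +-congˡ (-‿cong (≈-trans (zeroˡ _) (≈-sym (+-identityʳ 0#)))) ⟩
        t a * t b - (0# + 0#)
          ≈⟨ +-congˡ (≈-trans (-‿cong (+-identityʳ 0#)) (≈-trans (≈-sym (+-identityˡ _)) (-‿inverseʳ 0#))) ⟩
        t a * t b + 0#
          ≈⟨ +-identityʳ _ ⟩
        t a * t b ∎

  module _ {g ℓg} {G : Group g ℓg} where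

    trace-⨂ : ∀ {m} (W : Fin m → Representation G) x →
              trace (ρ (⨂ W) x) ≈ ∏ (λ i → trace (ρ (W i) x))
    trace-⨂ {zero}  W x = +-identityʳ 1#
    trace-⨂ {suc m} W x = ≈-trans
      (trace-kronecker (ρ (W zero) x) (ρ (⨂ (W ∘ suc)) x)) (*-congˡ (trace-⨂ (W ∘ suc) x))

    trace-^⊗ : ∀ (W : Representation G) m x → trace (ρ (W ^⊗ m) x) ≈ trace (ρ W x) ^ m
    trace-^⊗ W m x = ≈-trans (trace-⨂ {m} (λ _ → W) x) (∏.sum-replicate m)

    χ-⊖ : ∀ (U W : Representation G) m x →
          χ (⟦ U ⟧ ⊖ + m · ⟦ W ⟧) x ≈ trace (ρ U x) - m ℕ· trace (ρ W x)
    χ-⊖ U W m x = +-cong (+-identityʳ _) (≈-trans (+-identityʳ _)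
      (≈-trans (reflexive (cong scale coefficient)) (negative m)))
      where
      scale : ℤ → A
      scale c = _ℤ·_ {G = G} c (trace (ρ W x))
      coefficient : (ℤ.- (+ 1)) ℤ.* ((+ m) ℤ.* (+ 1)) ≡ ℤ.- (+ m)
      coefficient = ≡.trans (ℤ.-1*i≡-i _) (cong ℤ.-_ (ℤ.*-identityʳ (+ m)))
      negative : ∀ m → scale (ℤ.- (+ m)) ≈ - (m ℕ· trace (ρ W x))
      -- The integer negative of `+ 0` is again `+ 0`, so this case compares zero with its negative
      -- in the ring.
      negative zero    = ≈-trans (≈-sym (-‿inverseʳ 0#)) (+-identityˡ _)
      negative (suc m) = ≈-refl

  -- Each of the `k` factors absorbs one 2; this is where the coefficient of the second tensor
  -- product comes from.
  ∏-double : ∀ k (u : Fin k → A) → (2 ℕ.^ k) ℕ· ∏ u ≈ ∏ (λ i → u i + u i)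
  ∏-double zero    u = +-identityʳ 1#
  ∏-double (suc k) u = begin
    (2 ℕ.* 2 ℕ.^ k) ℕ· (u zero * ∏ (u ∘ suc))
      ≈⟨ ℕ·-assocˡ (u zero * ∏ (u ∘ suc)) 2 (2 ℕ.^ k) ⟨
    2 ℕ· ((2 ℕ.^ k) ℕ· (u zero * ∏ (u ∘ suc)))
      ≈⟨ ℕ·-congʳ 2 (×-comm-* (2 ℕ.^ k) (u zero) (∏ (u ∘ suc))) ⟨
    2 ℕ· (u zero * ((2 ℕ.^ k) ℕ· ∏ (u ∘ suc)))
      ≈⟨ ℕ·-congʳ 2 (*-congˡ (∏-double k (u ∘ suc))) ⟩
    2 ℕ· (u zero * ∏ (λ i → u (suc i) + u (suc i)))
      ≈⟨ ×-assoc-* 2 (u zero) _ ⟨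
    2 ℕ· u zero * ∏ (λ i → u (suc i) + u (suc i))
      ≈⟨ *-congʳ (+-congˡ (+-identityʳ (u zero))) ⟩
    ∏ (λ i → u i + u i) ∎

  module _ {g ℓg} {G : Group g ℓg} {k} (V Z : Fin k → Representation G) (x : Group.Carrier G)
           (s d : Fin k → A) (trace-V : ∀ i → trace (ρ (V i) x) ≈ s i)
           (trace-Z : ∀ i → trace (ρ (Z i) x) + trace (ρ (Z i) x) ≈ d i) where

    private
      e : Fin k → A
      e i = trace (ρ (Z i) x)

      tensorPower : ∀ i m → trace (ρ (V i ^⊗ m) x) ≈ s i ^ m
      tensorPower i m = ≈-trans (trace-^⊗ (V i) m x) (^-congˡ m (trace-V i))

    -- Traces turn tensor products into products, so only the traces of the `V i` and the doubled
    -- traces of the `Z i` enter, the doublings being supplied by the coefficient. The additive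
    -- identity for `p` is then solved for `p`.
    χ-tensorPowers : (a b : Fin k → ℕ) → ∀ p →
      p + ∏ (λ i → s i ^ b i * d i) ≈ ∏ (λ i → s i ^ a i) →
      p ≈ χ ( ⟦ ⨂ (λ i → V i ^⊗ a i) ⟧
              ⊖ + (2 ℕ.^ k) · ⟦ ⨂ (λ i → V i ^⊗ b i ⊗ Z i) ⟧ ) x
    χ-tensorPowers a b p p+N≈T = ≈-trans difference (≈-sym (≈-trans
      (χ-⊖ (⨂ (λ i → V i ^⊗ a i)) (⨂ (λ i → V i ^⊗ b i ⊗ Z i)) (2 ℕ.^ k) x)
      (+-cong total (-‿cong pairs))))
      where
      N = ∏ (λ i → s i ^ b i * d i)
      total : trace (ρ (⨂ (λ i → V i ^⊗ a i)) x) ≈ ∏ (λ i → s i ^ a i)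
      total = ≈-trans (trace-⨂ (λ i → V i ^⊗ a i) x) (∏.sum-cong-≋ (λ i → tensorPower i (a i)))
      factors : ∀ i → trace (ρ (V i ^⊗ b i ⊗ Z i) x) ≈ s i ^ b i * e i
      factors i = ≈-trans (trace-kronecker (ρ (V i ^⊗ b i) x) (ρ (Z i) x))
        (*-congʳ {e i} (tensorPower i (b i)))
      pairs : (2 ℕ.^ k) ℕ· trace (ρ (⨂ (λ i → V i ^⊗ b i ⊗ Z i)) x) ≈ N
      pairs = begin
        (2 ℕ.^ k) ℕ· trace (ρ (⨂ (λ i → V i ^⊗ b i ⊗ Z i)) x)
          ≈⟨ ℕ·-congʳ (2 ℕ.^ k) (≈-trans (trace-⨂ (λ i → V i ^⊗ b i ⊗ Z i) x)
               (∏.sum-cong-≋ factors)) ⟩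
        (2 ℕ.^ k) ℕ· ∏ (λ i → s i ^ b i * e i)
          ≈⟨ ∏-double k (λ i → s i ^ b i * e i) ⟩
        ∏ (λ i → s i ^ b i * e i + s i ^ b i * e i)
          ≈⟨ ∏.sum-cong-≋ (λ i → ≈-trans (≈-sym (distribˡ (s i ^ b i) (e i) (e i)))
               (*-congˡ {s i ^ b i} (trace-Z i))) ⟩
        N ∎
      difference : p ≈ ∏ (λ i → s i ^ a i) - N
      difference = begin
        p                         ≈⟨ +-identityʳ p ⟨
        p + 0#                    ≈⟨ +-congˡ (-‿inverseʳ N) ⟨
        p + (N - N)               ≈⟨ +-assoc p N (- N) ⟨
        p + N - N                 ≈⟨ +-congʳ p+N≈T ⟩
        ∏ (λ i → s i ^ a i) - N   ∎

open import Data.Nat.Base using (_^_)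

corollary3p3 :
  ∀ {r ℓ a} (R : CommutativeRing r ℓ)
    (k : ℕ) .{{_ : NonZero k}}
    (X : Fin k → Set a) (n : Fin k → ℕ)
    (nonempty : ∀ i → NonZero (n i))
    (enum : ∀ i → X i ↔ Fin (n i))
    (x : ∀ i → X i → Unit (CommutativeRing.*-monoid R)) →
  let open CommutativeRing R using (_≈_)
      open Representations R
      open Cyclic k using (prev)
      open Tuples k X n enum
      V = fundamental n
  in
    -- If n (prev i) is 1 then Λ² (V (prev i)), and so the second ⨂, has dimension 0.
    P R (λ i v → Unit.value (x i v))
      ≈ χ ( ⟦ ⨂ (λ i → V i ^⊗ n (prev i)) ⟧
            ⊖ + (2 ^ k) · ⟦ ⨂ (λ i → V i ^⊗ (n (prev i) ∸ 2) ⊗ Λ² (V i)) ⟧ )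
          (λ i → diag (x i ∘ element i))
corollary3p3 R k X n nonempty enum x =
  χ-tensorPowers V (λ i → Λ² (V i)) t (λ i → sum (y i)) (λ i → distinct (y i))
    (λ i → trace-diagonal (y i)) (λ i → trace-exteriorSquare (y i))
    (n ∘ prev) (λ i → n (prev i) ∸ 2) (P R w) (P-sum-prev R k X n nonempty enum w)
  where
  open CommutativeRing R using (Carrier)
  open Enumeration R using (sum)
  open TupleSum R using (distinct)
  open Characters R
  open Representations R
  open Cyclic k
  open Tuples k X n enum
  w : ∀ i → X i → Carrier
  w i v = Unit.value (x i v)
  y : ∀ i → Fin (n i) → Carrier
  y i = w i ∘ element i
  t : Group.Carrier (∏GL n)
  t i = diag (x i ∘ element i)
  V = fundamental n
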